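{- Let $k\ge 3$ be an integer, let $\varepsilon^*\in\{0,1\}$ be the remainder of $k$ upon division by $2$, let $n$ be an integer, and let $\varepsilon\in\{0,1\}$ be the remainder of $n$ upon division by $2$. If $n\ge 3k+3+\varepsilon(2\varepsilon^*-1)$, then there exists a $(C_4,K_{1,k})$-co-critical graph $G$ on $n$ vertices such that \[ e(G)=\begin{cases}\dfrac{(k+2)n}{2}-\dfrac{(2+\varepsilon)k-4\varepsilon}{2} & \text{if } k \text{ is odd},\\[2mm] \dfrac{(k+2)n}{2}-\dfrac{(2-\varepsilon)k-2(1-2\varepsilon)}{2} & \text{if } k \text{ is even}.\end{cases} \]
   Context: All graphs are finite, simple, without loops or multiple edges; $e(G)$ denotes the number of edges of $G$. For a graph $G$, a $\{\text{red},\text{blue}\}$-coloring of $E(G)$ is a critical coloring if $G$ contains neither a red copy of $C_4$ (the cycle on 4 vertices, as a not necessarily induced subgraph) nor a blue copy of $K_{1,k}$ (the star with $k$ leaves). A non-complete graph $G$ is $(C_4,K_{1,k})$-co-critical if $G$ admits a critical coloring, but for every edge $e$ of the complement of $G$, the graph $G+e$ (obtained by adding $e$) admits no critical coloring. -}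

module Defs where

open import Data.Nat using (ℕ; _+_; _*_; _<ᵇ_)
open import Data.Bool using (Bool; true; false; _∧_; _∨_; if_then_else_)
open import Data.Fin using (Fin; toℕ; _≟_)
open import Data.List using (List; map; allFin; cartesianProduct)
open import Data.Nat.ListAction using (sum)
open import Data.Product using (Σ; ∃; _×_; _,_; proj₁; proj₂)
open import Relation.Nullary using (¬_)
open import Relation.Nullary.Decidable using (⌊_⌋)
open import Relation.Binary.PropositionalEquality using (_≡_; _≢_)
open import Function.Definitions using (Injective)

record Graph (n : ℕ) : Set where
  field
    adj     : Fin n → Fin n → Bool
    sym     : ∀ x y → adj x y ≡ adj y x
    irrefl  : ∀ x → adj x x ≡ false
open Graph public

edgeCount : ∀ {n} → Graph n → ℕ
edgeCount {n} G =
  sum (map (λ p → if (toℕ (proj₁ p) <ᵇ toℕ (proj₂ p)) ∧ adj G (proj₁ p) (proj₂ p)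
                  then 1 else 0)
           (cartesianProduct (allFin n) (allFin n)))

data Colour : Set where
  red blue : Colour

-- A red/blue colouring of the edges of a graph with adjacency A:
-- a colour for each (unordered) pair, i.e. a symmetric function
-- (its values on non-edges are irrelevant).
record Colouring (n : ℕ) : Set where
  field
    col    : Fin n → Fin n → Colour
    colSym : ∀ x y → col x y ≡ col y x
open Colouring public

RedC4 : ∀ {n} → (Fin n → Fin n → Bool) → Colouring n → Set
RedC4 {n} A c =
  Σ (Fin n) λ a → Σ (Fin n) λ b → Σ (Fin n) λ d' → Σ (Fin n) λ d →
    (a ≢ b) × (a ≢ d') × (a ≢ d) × (b ≢ d') × (b ≢ d) × (d' ≢ d) ×
    (A a b ≡ true) × (A b d' ≡ true) × (A d' d ≡ true) × (A d a ≡ true) ×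
    (col c a b ≡ red) × (col c b d' ≡ red) × (col c d' d ≡ red) × (col c d a ≡ red)

-- Blue copy of K_{1,k}: a centre v and k distinct leaves, each joined to v
-- by a blue edge (leaves differ from v since the graph is loopless).
BlueStar : ∀ {n} → ℕ → (Fin n → Fin n → Bool) → Colouring n → Set
BlueStar {n} k A c =
  Σ (Fin n) λ v → Σ (Fin k → Fin n) λ leaf →
    Injective _≡_ _≡_ leaf ×
    (∀ i → A v (leaf i) ≡ true) × (∀ i → col c v (leaf i) ≡ blue)

CriticalColouring : ∀ {n} → ℕ → (Fin n → Fin n → Bool) → Colouring n → Set
CriticalColouring k A c = ¬ RedC4 A c × ¬ BlueStar k A c

AdmitsCritical : ∀ {n} → ℕ → (Fin n → Fin n → Bool) → Set
AdmitsCritical {n} k A = Σ (Colouring n) λ c → CriticalColouring k A c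

addEdge : ∀ {n} → (Fin n → Fin n → Bool) → Fin n → Fin n → Fin n → Fin n → Bool
addEdge A u v x y = A x y ∨ ((⌊ x ≟ u ⌋ ∧ ⌊ y ≟ v ⌋) ∨ (⌊ x ≟ v ⌋ ∧ ⌊ y ≟ u ⌋))

NonComplete : ∀ {n} → Graph n → Set
NonComplete {n} G = Σ (Fin n) λ u → Σ (Fin n) λ v → (u ≢ v) × (adj G u v ≡ false)

CoCritical : ∀ {n} → ℕ → Graph n → Set
CoCritical {n} k G =
  NonComplete G × AdmitsCritical k (adj G) ×
  (∀ (u v : Fin n) → u ≢ v → adj G u v ≡ false → ¬ AdmitsCritical k (addEdge (adj G) u v))

module Submission where

-- Write k = κ + 1.  A hub X is joined in red to all vertices of a k-regular bipartite graph with
-- sides Le and Ri, in which a perfect matching is red, and in blue to k - 1 further vertices.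
-- These k - 1 vertices and one more (together: K) and two or three others (L, a clique) form a
-- core, all of it joined in red to r₀ = Le zero.  Inside the core a red matching covers K, and
-- every vertex of K has degree k + 1.
--
-- In a critical colouring of the graph plus an edge, r₀ needs so many red edges that the blue
-- neighbours of X must be exactly its k - 1 neighbours in K, the whole core is red to r₀, and
-- Le and Ri are red to X.  Avoiding a red C₄, every vertex but X and r₀ then has red degree at
-- most 2, hence degree at most k + 1; but one end of the new edge had degree k + 1 before.
--
-- The core tunes the number of edges.  For k odd, K is a clique joined to L by one edge.  For k
-- even, K is a clique minus a matching missing two vertices; each matched vertex and one of the
-- two others get an edge to L instead.

open import Defs hiding (sym)
open import Data.Nat using (ℕ; zero; suc; _+_; _*_; _∸_; _≤_; _<_; z≤n; s≤s; _<ᵇ_; _≡ᵇ_; _%_)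
open import Data.Nat.Properties hiding (_≟_; suc-injective)
import Data.Nat.ListAction as List
open import Data.Nat.ListAction.Properties using (sum-++)
open import Data.Nat.Tactic.RingSolver using (solve-∀)
open import Data.Bool using (Bool; true; false; _∧_; _∨_; not; if_then_else_)
open import Data.Bool.Properties
  using (T-≡; ¬-not; ∧-comm; ∨-comm; ∧-zeroʳ; ∨-zeroʳ; ∧-identityʳ; ∧-inverseʳ; ∧-conicalˡ; ∧-conicalʳ)
open import Data.Fin using (Fin; zero; suc; toℕ; fromℕ; fromℕ<; _≟_; _↑ˡ_; _↑ʳ_; splitAt; opposite)
open import Data.Fin.Properties
  using ( toℕ-injective; toℕ<n; toℕ≤pred[n]; toℕ-fromℕ; toℕ-fromℕ<; toℕ-↑ˡ; toℕ-↑ʳ; opposite-prop; suc-injective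
        ; splitAt-↑ˡ; splitAt-↑ʳ; splitAt⁻¹-↑ˡ; splitAt⁻¹-↑ʳ)
open import Data.List using (List; []; _∷_; _++_; map; allFin; tabulate; cartesianProduct)
open import Data.List.Properties using (map-++; map-tabulate; map-∘)
open import Data.Product using (Σ; ∃; _×_; _,_; proj₁; proj₂)
open import Data.Sum using (_⊎_; inj₁; inj₂)
open import Data.Empty using (⊥; ⊥-elim)
open import Function using (_∘_; _↔_; Inverse; Equivalence; mk↔ₛ′)
open import Function.Construct.Identity using (↔-id)
open import Function.Definitions using (Injective)
open import Relation.Nullary using (¬_; yes; no; contradiction)
open import Relation.Nullary.Decidable using (⌊_⌋)
open import Relation.Binary.Definitions using (tri<; tri≈; tri>)
open import Relation.Binary.PropositionalEquality hiding ([_])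
open import Algebra.Properties.CommutativeMonoid.Sum +-0-commutativeMonoid
  using (sum; sum-cong-≗; sum-replicate-zero; ∑-distrib-+; ∑-comm)

-- Booleans and sums over finite index sets

[_] : Bool → ℕ
[ b ] = if b then 1 else 0

true≢false : ∀ {b} → b ≡ true → b ≡ false → ⊥
true≢false refl ()

bool-cases : ∀ b → b ≡ true ⊎ b ≡ false
bool-cases true  = inj₁ refl
bool-cases false = inj₂ refl

∧-true : ∀ {a b} → a ≡ true → b ≡ true → a ∧ b ≡ true
∧-true refl refl = refl

∨-true : ∀ a {b} → a ∨ b ≡ true → a ≡ true ⊎ b ≡ true
∨-true true  _ = inj₁ refl
∨-true false e = inj₂ e

[]-mono : ∀ {a b} → (a ≡ true → b ≡ true) → [ a ] ≤ [ b ]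
[]-mono {false}         f = z≤n
[]-mono {true}  {true}  f = ≤-refl
[]-mono {true}  {false} f with () ← f refl

isYes-true : ∀ {n} (i j : Fin n) → ⌊ i ≟ j ⌋ ≡ true → i ≡ j
isYes-true i j e with i ≟ j
... | yes i≡j = i≡j
isYes-true i j () | no _

isYes-refl : ∀ {n} (i : Fin n) → ⌊ i ≟ i ⌋ ≡ true
isYes-refl i with i ≟ i
... | yes _  = refl
... | no i≢i = contradiction refl i≢i

isYes-sym : ∀ {n} (i j : Fin n) → ⌊ i ≟ j ⌋ ≡ ⌊ j ≟ i ⌋
isYes-sym i j with i ≟ j | j ≟ i
... | yes _    | yes _   = refl
... | no _     | no _    = refl
... | yes refl | no j≢i  = contradiction refl j≢i
... | no i≢j   | yes j≡i = contradiction (sym j≡i) i≢j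

sum-mono : ∀ {n} {f g : Fin n → ℕ} → (∀ i → f i ≤ g i) → sum f ≤ sum g
sum-mono {zero}  f≤g = z≤n
sum-mono {suc n} f≤g = +-mono-≤ (f≤g zero) (sum-mono (f≤g ∘ suc))

sum-const : ∀ n c → sum {n} (λ _ → c) ≡ n * c
sum-const zero    c = refl
sum-const (suc n) c = cong (c +_) (sum-const n c)

sum-zero : ∀ {n} {f : Fin n → ℕ} → (∀ i → f i ≡ 0) → sum f ≡ 0
sum-zero {n} f≡0 = trans (sum-cong-≗ f≡0) (sum-replicate-zero n)

sum-split : ∀ m {n} (f : Fin (m + n) → ℕ) →
            sum f ≡ sum (λ i → f (i ↑ˡ n)) + sum (λ j → f (m ↑ʳ j))
sum-split zero    f = refl
sum-split (suc m) f = trans (cong (f zero +_) (sum-split m (f ∘ suc)))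
                            (sym (+-assoc (f zero) _ _))

sum-≟ : ∀ {n} (j : Fin n) → sum (λ i → [ ⌊ i ≟ j ⌋ ]) ≡ 1
sum-≟ {suc n} zero    = cong suc (sum-zero {n} λ _ → refl)
sum-≟ {suc n} (suc j) = trans (sum-cong-≗ shift) (sum-≟ j)
  where
  shift : ∀ i → [ ⌊ suc i ≟ suc j ⌋ ] ≡ [ ⌊ i ≟ j ⌋ ]
  shift i with i ≟ j
  ... | yes _ = refl
  ... | no _  = refl

-- Cardinalities of decidable subsets of an enumerated type

module Counting {n} {A : Set} (enum : Fin n ↔ A) where
  open Inverse enum

  count : (A → Bool) → ℕ
  count p = sum (λ i → [ p (to i) ])

  infix 7 _==_
  _==_ : A → A → Bool
  a == b = ⌊ from a ≟ from b ⌋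

  ==⇒≡ : ∀ a b → a == b ≡ true → a ≡ b
  ==⇒≡ a b e = begin
    a              ≡⟨ strictlyInverseˡ a ⟨
    to (from a)    ≡⟨ cong to (isYes-true _ _ e) ⟩
    to (from b)    ≡⟨ strictlyInverseˡ b ⟩
    b              ∎
    where open ≡-Reasoning

  ==-refl : ∀ a → a == a ≡ true
  ==-refl a = isYes-refl (from a)

  ≢⇒== : ∀ {a b} → a ≢ b → a == b ≡ false
  ≢⇒== {a} {b} a≢b = ¬-not λ e → a≢b (==⇒≡ a b e)

  count-cong : ∀ {p q : A → Bool} → (∀ a → p a ≡ q a) → count p ≡ count q
  count-cong p≗q = sum-cong-≗ λ i → cong [_] (p≗q (to i))

  count-mono : ∀ {p q : A → Bool} → (∀ a → p a ≡ true → q a ≡ true) → count p ≤ count q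
  count-mono p⊆q = sum-mono λ i → []-mono (p⊆q (to i))

  count-none : ∀ {p : A → Bool} → (∀ a → p a ≡ false) → count p ≡ 0
  count-none none = sum-zero λ i → cong [_] (none (to i))

  count-∨ : ∀ {p q r : A → Bool} → (∀ a → p a ≡ true → q a ≡ true ⊎ r a ≡ true) →
            count p ≤ count q + count r
  count-∨ {p} {q} {r} cover = begin
    count p                                          ≤⟨ sum-mono (λ i → pointwise (cover (to i))) ⟩
    sum (λ i → [ q (to i) ] + [ r (to i) ])          ≡⟨ ∑-distrib-+ (λ i → [ q (to i) ]) (λ i → [ r (to i) ]) ⟩
    count q + count r                                ∎
    where
    open ≤-Reasoning
    pointwise : ∀ {a b c} → (a ≡ true → b ≡ true ⊎ c ≡ true) → [ a ] ≤ [ b ] + [ c ]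
    pointwise {false}                 f = z≤n
    pointwise {true} {true}           f = s≤s z≤n
    pointwise {true} {false} {true}   f = s≤s z≤n
    pointwise {true} {false} {false}  f with f refl
    ... | inj₁ ()
    ... | inj₂ ()

  count-partition : ∀ (p q : A → Bool) → count p ≡ count (λ a → p a ∧ q a) + count (λ a → p a ∧ not (q a))
  count-partition p q =
    trans (sum-cong-≗ λ i → pointwise (p (to i)) (q (to i)))
          (∑-distrib-+ (λ i → [ p (to i) ∧ q (to i) ]) (λ i → [ p (to i) ∧ not (q (to i)) ]))
    where
    pointwise : ∀ a b → [ a ] ≡ [ a ∧ b ] + [ a ∧ not b ]
    pointwise false _     = refl
    pointwise true  true  = refl
    pointwise true  false = refl

  count-== : ∀ b → count (_== b) ≡ 1
  count-== b = trans (sum-cong-≗ λ i → cong (λ j → [ ⌊ j ≟ from b ⌋ ]) (strictlyInverseʳ i))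
                     (sum-≟ (from b))

  remove : A → (A → Bool) → A → Bool
  remove b p a = p a ∧ not (a == b)

  count-remove : ∀ p b → p b ≡ true → count p ≡ suc (count (remove b p))
  count-remove p b pb = trans (count-partition p (_== b)) (cong (_+ count (remove b p)) (begin
    count (λ a → p a ∧ (a == b)) ≡⟨ count-cong {λ a → p a ∧ (a == b)} {_== b} only-b ⟩
    count (_== b)                ≡⟨ count-== b ⟩
    1                            ∎))
    where
    open ≡-Reasoning
    only-b : ∀ a → p a ∧ (a == b) ≡ (a == b)
    only-b a with a == b in e
    ... | false = ∧-zeroʳ (p a)
    ... | true rewrite ==⇒≡ a b e | pb = refl

  count-remove-≤ : ∀ p b → count p ≤ suc (count (remove b p))
  count-remove-≤ p b with p b in e
  ... | true  = ≤-reflexive (count-remove p b e)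
  ... | false = m≤n⇒m≤1+n (count-mono {p} {remove b p} λ a pa → ∧-true pa (cong not (≢⇒== λ { refl → true≢false pa e })))

  remove⇒ : ∀ p b a → remove b p a ≡ true → p a ≡ true × a ≢ b
  remove⇒ p b a e = ∧-conicalˡ _ _ e ,
    λ { refl → true≢false (∧-conicalʳ _ _ e) (cong not (==-refl b)) }

  count-strict : ∀ {p q : A → Bool} → (∀ a → p a ≡ true → q a ≡ true) →
                 ∀ b → p b ≡ false → q b ≡ true → count p < count q
  count-strict {p} {q} p⊆q b ¬pb qb = begin-strict
    count p                   ≤⟨ count-mono {p} {remove b q} (λ a pa → ∧-true (p⊆q a pa) (cong not (≢⇒== λ { refl → true≢false pa ¬pb }))) ⟩
    count (remove b q)        <⟨ n<1+n _ ⟩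
    suc (count (remove b q))  ≡⟨ count-remove q b qb ⟨
    count q                   ∎
    where open ≤-Reasoning

  -- Turns an attained cardinality bound into an equality of sets; this is how the extremal count at
  -- `r₀` yields structural information later.
  count-full : ∀ {p q : A → Bool} → (∀ a → p a ≡ true → q a ≡ true) → count q ≤ count p →
               ∀ b → q b ≡ true → p b ≡ true
  count-full {p} p⊆q q≤p b qb with p b in e
  ... | true  = refl
  ... | false = contradiction q≤p (<⇒≱ (count-strict p⊆q b e qb))

  count-∃ : ∀ p → 0 < count p → ∃ λ a → p a ≡ true
  count-∃ p 0<p = let i , e = go (p ∘ to) 0<p in to i , e
    where
    go : ∀ {n} (q : Fin n → Bool) → 0 < sum (λ i → [ q i ]) → ∃ λ i → q i ≡ true
    go {suc n} q 0<q with q zero in e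
    ... | true  = zero , e
    ... | false = let i , e′ = go (q ∘ suc) 0<q in suc i , e′

  count-∃≢ : ∀ p b → 1 < count p → ∃ λ a → p a ≡ true × a ≢ b
  count-∃≢ p b 1<p =
    let a , e = count-∃ (remove b p) (≤-pred (≤-trans 1<p (count-remove-≤ p b)))
    in a , remove⇒ p b a e

  count-∃₂≢ : ∀ p b → 2 < count p →
              ∃ λ a → ∃ λ a′ → (p a ≡ true × a ≢ b) × (p a′ ≡ true × a′ ≢ b) × a ≢ a′
  count-∃₂≢ p b 2<p =
    let q          = remove b p
        1<q        = ≤-pred (≤-trans 2<p (count-remove-≤ p b))
        a  , qa    = count-∃ q (<⇒≤ 1<q)
        a′ , qa′ , a′≢a = count-∃≢ q a 1<q
    in a , a′ , remove⇒ p b a qa , remove⇒ p b a′ qa′ , λ a≡a′ → a′≢a (sym a≡a′)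

  count-≤1 : ∀ {p : A → Bool} → (∀ a b → p a ≡ true → p b ≡ true → a ≡ b) → count p ≤ 1
  count-≤1 {p} unique = ≮⇒≥ λ 1<p →
    let a  , pa         = count-∃ p (<⇒≤ 1<p)
        a′ , pa′ , a′≢a = count-∃≢ p a 1<p
    in a′≢a (unique a′ a pa′ pa)

  count-unique : ∀ {p : A → Bool} b → p b ≡ true → (∀ a → p a ≡ true → a ≡ b) → count p ≡ 1
  count-unique {p} b pb unique =
    trans (count-remove p b pb) (cong suc (count-none {remove b p} λ a → ¬-not λ e →
      let pa , a≢b = remove⇒ p b a e in a≢b (unique a pa)))

  -- Together with `injection⇒count`, this translates between the injective leaf maps of `BlueStar`
  -- and bounds on blue degrees.
  count⇒injection : ∀ k p → k ≤ count p →
    Σ (Fin k → A) λ f → Injective _≡_ _≡_ f × (∀ i → p (f i) ≡ true)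
  count⇒injection zero    p _   = (λ ()) , (λ { {()} }) , λ ()
  count⇒injection (suc k) p k<p =
    let b , pb       = count-∃ p (≤-trans (s≤s z≤n) k<p)
        f , inj , pf = count⇒injection k (remove b p) (≤-pred (subst (suc k ≤_) (count-remove p b pb) k<p))
        g            = λ { zero → b ; (suc i) → f i }
    in g
     , (λ { {zero}  {zero}  _ → refl
          ; {zero}  {suc j} e → contradiction (sym e) (proj₂ (remove⇒ p b (f j) (pf j)))
          ; {suc i} {zero}  e → contradiction e (proj₂ (remove⇒ p b (f i) (pf i)))
          ; {suc i} {suc j} e → cong suc (inj e) })
     , λ { zero → pb ; (suc i) → proj₁ (remove⇒ p b (f i) (pf i)) }

  injection⇒count : ∀ k p (f : Fin k → A) → Injective _≡_ _≡_ f →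
                    (∀ i → p (f i) ≡ true) → k ≤ count p
  injection⇒count zero    p f inj pf = z≤n
  injection⇒count (suc k) p f inj pf =
    subst (suc k ≤_) (sym (count-remove p (f zero) (pf zero)))
      (s≤s (injection⇒count k (remove (f zero) p) (f ∘ suc) (λ e → suc-injective (inj e))
        λ i → ∧-true (pf (suc i)) (cong not (≢⇒== λ e → case (inj e)))))
    where
    case : ∀ {i : Fin k} → suc i ≡ zero → ⊥
    case ()

-- Slack in one bound would have to be made up by the other. Nested applications peel the summands
-- off a longer sum of bounds.
tight : ∀ {a b A B} → a ≤ A → b ≤ B → A + B ≤ a + b → A ≤ a × B ≤ b
tight {a} {b} {A} {B} a≤A b≤B h =
    +-cancelʳ-≤ B A a (≤-trans h (+-monoʳ-≤ a b≤B))
  , +-cancelˡ-≤ A B b (≤-trans h (+-monoˡ-≤ b a≤A))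

<ᵇ-true : ∀ {i j} → i < j → (i <ᵇ j) ≡ true
<ᵇ-true = Equivalence.to T-≡ ∘ <⇒<ᵇ

<ᵇ⇒<′ : ∀ i j → (i <ᵇ j) ≡ true → i < j
<ᵇ⇒<′ i j = <ᵇ⇒< i j ∘ Equivalence.from T-≡

≡ᵇ⇒≡′ : ∀ i j → (i ≡ᵇ j) ≡ true → i ≡ j
≡ᵇ⇒≡′ i j = ≡ᵇ⇒≡ i j ∘ Equivalence.from T-≡

≡ᵇ-refl : ∀ i → (i ≡ᵇ i) ≡ true
≡ᵇ-refl i = Equivalence.to T-≡ (≡⇒≡ᵇ i i refl)

<ᵇ-false : ∀ {i j} → j ≤ i → (i <ᵇ j) ≡ false
<ᵇ-false {i} {j} j≤i = ¬-not λ e → <⇒≱ (<ᵇ⇒<′ i j e) j≤i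

not-false : ∀ {b} → not b ≡ true → b ≡ false
not-false {false} _ = refl

not-true : ∀ {b} → not b ≡ false → b ≡ true
not-true {true} _ = refl

-- The degree sum of a graph

sum-list-tabulate : ∀ {n} (f : Fin n → ℕ) → List.sum (tabulate f) ≡ sum f
sum-list-tabulate {zero}  f = refl
sum-list-tabulate {suc n} f = cong (f zero +_) (sum-list-tabulate (f ∘ suc))

sum-list-allFin : ∀ {n} (f : Fin n → ℕ) → List.sum (map f (allFin n)) ≡ sum f
sum-list-allFin f = trans (cong List.sum (map-tabulate (λ i → i) f)) (sum-list-tabulate f)

sum-cartesianProduct : ∀ {A B : Set} (f : A × B → ℕ) (xs : List A) (ys : List B) →
  List.sum (map f (cartesianProduct xs ys)) ≡ List.sum (map (λ x → List.sum (map (λ y → f (x , y)) ys)) xs)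
sum-cartesianProduct f []       ys = refl
sum-cartesianProduct f (x ∷ xs) ys = begin
  List.sum (map f (map (x ,_) ys ++ cartesianProduct xs ys))
    ≡⟨ cong List.sum (map-++ f (map (x ,_) ys) _) ⟩
  List.sum (map f (map (x ,_) ys) ++ map f (cartesianProduct xs ys))
    ≡⟨ sum-++ (map f (map (x ,_) ys)) _ ⟩
  List.sum (map f (map (x ,_) ys)) + List.sum (map f (cartesianProduct xs ys))
    ≡⟨ cong₂ _+_ (cong List.sum (sym (map-∘ ys))) (sum-cartesianProduct f xs ys) ⟩
  _ ∎
  where open ≡-Reasoning

-- `edgeCount` sees each edge in its increasing orientation only. Adding the same double sum with
-- the two indices exchanged supplies the other orientation.
handshake : ∀ {n} (G : Graph n) → 2 * edgeCount G ≡ sum (λ i → sum (λ j → [ adj G i j ]))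
handshake {n} G = begin
  2 * edgeCount G
    ≡⟨ cong (edgeCount G +_) (+-identityʳ (edgeCount G)) ⟩
  edgeCount G + edgeCount G
    ≡⟨ cong₂ _+_ as-sum (trans as-sum (∑-comm {n} {n} up)) ⟩
  sum (λ i → sum (λ j → up i j)) + sum (λ i → sum (λ j → up j i))
    ≡⟨ ∑-distrib-+ {n} (λ i → sum (up i)) (λ i → sum (λ j → up j i)) ⟨
  sum (λ i → sum (λ j → up i j) + sum (λ j → up j i))
    ≡⟨ sum-cong-≗ {n} (λ i → sym (∑-distrib-+ {n} (up i) (λ j → up j i))) ⟩
  sum (λ i → sum (λ j → up i j + up j i))
    ≡⟨ sum-cong-≗ {n} (λ i → sum-cong-≗ {n} (pointwise i)) ⟩
  sum (λ i → sum (λ j → [ adj G i j ])) ∎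
  where
  open ≡-Reasoning
  up : Fin n → Fin n → ℕ
  up i j = [ (toℕ i <ᵇ toℕ j) ∧ adj G i j ]
  as-sum : edgeCount G ≡ sum (λ i → sum (up i))
  as-sum = trans (sum-cartesianProduct _ (allFin n) (allFin n))
             (trans (sum-list-allFin {n} _) (sum-cong-≗ {n} λ i → sum-list-allFin {n} (up i)))
  pointwise : ∀ i j → up i j + up j i ≡ [ adj G i j ]
  pointwise i j with <-cmp (toℕ i) (toℕ j)
  ... | tri< i<j _ _ rewrite <ᵇ-true i<j | <ᵇ-false (<⇒≤ i<j) = +-identityʳ _
  ... | tri≈ _ i≡j _ with refl ← toℕ-injective i≡j
    rewrite <ᵇ-false (≤-refl {toℕ i}) | Graph.irrefl G i = refl
  ... | tri> _ _ i>j rewrite <ᵇ-true i>j | <ᵇ-false (<⇒≤ i>j) = cong [_] (Graph.sym G j i)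

-- Intervals of numbers and the pairing of consecutive numbers

sum-below : ∀ {n} d → d ≤ n → sum {n} (λ i → [ toℕ i <ᵇ d ]) ≡ d
sum-below {n}     zero    _         = sum-zero {n} λ _ → refl
sum-below {suc n} (suc d) (s≤s d≤n) = cong suc (sum-below d d≤n)

sum-not : ∀ {n} (p : Fin n → Bool) → sum (λ i → [ p i ]) + sum (λ i → [ not (p i) ]) ≡ n
sum-not {n} p = begin
  sum (λ i → [ p i ]) + sum (λ i → [ not (p i) ])  ≡⟨ ∑-distrib-+ (λ i → [ p i ]) (λ i → [ not (p i) ]) ⟨
  sum (λ i → [ p i ] + [ not (p i) ])              ≡⟨ sum-cong-≗ (λ i → one (p i)) ⟩
  sum {n} (λ _ → 1)                                ≡⟨ sum-const n 1 ⟩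
  n * 1                                            ≡⟨ *-identityʳ n ⟩
  n                                                ∎
  where
  open ≡-Reasoning
  one : ∀ b → [ b ] + [ not b ] ≡ 1
  one true  = refl
  one false = refl

window : ℕ → ℕ → ℕ → Bool
window lo len s = not (s <ᵇ lo) ∧ (s <ᵇ lo + len)

-- The two inequalities place the window inside the range of `i + toℕ t`. A common shift reduces to
-- `i = 0`, where the window is the difference of two initial segments.
sum-window : ∀ {n} i lo len → i ≤ lo → lo + len ≤ i + n →
             sum {n} (λ t → [ window lo len (i + toℕ t) ]) ≡ len
sum-window {n} zero lo len _ h = +-cancelˡ-≡ lo _ _ (begin
  lo + sum {n} (λ t → [ window lo len (toℕ t) ])
    ≡⟨ cong (_+ sum {n} (λ t → [ window lo len (toℕ t) ])) (sum-below {n} lo (≤-trans (m≤m+n lo len) h)) ⟨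
  sum {n} (λ t → [ toℕ t <ᵇ lo ]) + sum {n} (λ t → [ window lo len (toℕ t) ])
    ≡⟨ ∑-distrib-+ {n} (λ t → [ toℕ t <ᵇ lo ]) (λ t → [ window lo len (toℕ t) ]) ⟨
  sum {n} (λ t → [ toℕ t <ᵇ lo ] + [ window lo len (toℕ t) ])
    ≡⟨ sum-cong-≗ {n} (λ t → pointwise (toℕ t)) ⟩
  sum {n} (λ t → [ toℕ t <ᵇ lo + len ])
    ≡⟨ sum-below (lo + len) h ⟩
  lo + len ∎)
  where
  open ≡-Reasoning
  pointwise : ∀ t → [ t <ᵇ lo ] + [ window lo len t ] ≡ [ t <ᵇ lo + len ]
  pointwise t with t <ᵇ lo in e
  ... | false = refl
  ... | true rewrite <ᵇ-true (<-≤-trans (<ᵇ⇒<′ t lo e) (m≤m+n lo len)) = refl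
sum-window (suc i) (suc lo) len (s≤s i≤lo) (s≤s h) = sum-window i lo len i≤lo h

-- The involution exchanging 2i and 2i + 1. On core numbers it gives the red matching. Being defined
-- on all of `ℕ`, it may send the last core number outside the core.
partner : ℕ → ℕ
partner zero          = 1
partner (suc zero)    = 0
partner (suc (suc i)) = suc (suc (partner i))

partner-involutive : ∀ i → partner (partner i) ≡ i
partner-involutive zero          = refl
partner-involutive (suc zero)    = refl
partner-involutive (suc (suc i)) = cong (λ j → suc (suc j)) (partner-involutive i)

≡ᵇ-partner-sym : ∀ i j → (i ≡ᵇ partner j) ≡ (j ≡ᵇ partner i)
≡ᵇ-partner-sym zero          zero          = refl
≡ᵇ-partner-sym zero          (suc zero)    = refl
≡ᵇ-partner-sym zero          (suc (suc j)) = refl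
≡ᵇ-partner-sym (suc zero)    zero          = refl
≡ᵇ-partner-sym (suc zero)    (suc zero)    = refl
≡ᵇ-partner-sym (suc zero)    (suc (suc j)) = refl
≡ᵇ-partner-sym (suc (suc i)) zero          = refl
≡ᵇ-partner-sym (suc (suc i)) (suc zero)    = refl
≡ᵇ-partner-sym (suc (suc i)) (suc (suc j)) = ≡ᵇ-partner-sym i j

-- The core vertex K a has number toℕ a and L l has number suc κ + toℕ l; core vertices with
-- partner numbers are joined in red.  The summand [ toℕ a <ᵇ κ ] is the edge from K a to X.
record Core (κ ℓ : ℕ) : Set where
  field
    inner        : Fin (suc κ) → Fin (suc κ) → Bool
    outer        : Fin (suc κ) → Fin ℓ → Bool
    inner-sym    : ∀ a b → inner a b ≡ inner b a
    inner-irrefl : ∀ a → inner a a ≡ false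
    degree       : ∀ a → [ toℕ a <ᵇ κ ] + (sum (λ b → [ inner a b ]) + sum (λ l → [ outer a l ])) ≡ suc κ
    matched      : ∀ a → (∃ λ b → inner a b ≡ true × toℕ b ≡ partner (toℕ a)) ⊎
                         (∃ λ l → outer a l ≡ true × suc κ + toℕ l ≡ partner (toℕ a))
    blue-outer   : ∀ l →
      sum (λ a → [ outer a l ∧ not (suc κ + toℕ l ≡ᵇ partner (toℕ a)) ]) +
      sum (λ l′ → [ not ⌊ l ≟ l′ ⌋ ∧ not (suc κ + toℕ l′ ≡ᵇ partner (suc κ + toℕ l)) ]) ≤ κ

-- The degree sum, that is twice the number of edges, with the blocks in the order `X`, `K`, `L`,
-- `Le`, `Ri`. Here `E` stands for the number of edges between `K` and `L`.
edges : (κ ℓ μ E : ℕ) → ℕ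
edges κ ℓ μ E = κ + (suc μ + suc μ) + (suc κ * suc (suc κ) + (E + ℓ * ℓ +
  (suc μ + ((suc κ + ℓ) + suc μ * suc κ) + suc μ * suc (suc κ))))

order : (κ ℓ μ : ℕ) → ℕ
order κ ℓ μ = suc (suc κ + (ℓ + (suc μ + suc μ)))

-- The graph on a given core: vertices, adjacency and degrees

module Construction (κ ℓ μ : ℕ) (κ≤μ : κ ≤ μ) (core : Core κ ℓ) where
  open Core core

  data V : Set where
    X     : V
    K     : Fin (suc κ) → V
    L     : Fin ℓ → V
    Le Ri : Fin (suc μ) → V

  from : V → Fin (order κ ℓ μ)
  from X      = zero
  from (K a)  = suc (a ↑ˡ _)
  from (L l)  = suc (suc κ ↑ʳ (l ↑ˡ _))
  from (Le i) = suc (suc κ ↑ʳ (ℓ ↑ʳ (i ↑ˡ _)))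
  from (Ri j) = suc (suc κ ↑ʳ (ℓ ↑ʳ (suc μ ↑ʳ j)))

  toRim : Fin (suc μ) ⊎ Fin (suc μ) → V
  toRim (inj₁ i) = Le i
  toRim (inj₂ j) = Ri j

  toL : Fin ℓ ⊎ Fin (suc μ + suc μ) → V
  toL (inj₁ l) = L l
  toL (inj₂ r) = toRim (splitAt (suc μ) r)

  toK : Fin (suc κ) ⊎ Fin (ℓ + (suc μ + suc μ)) → V
  toK (inj₁ a) = K a
  toK (inj₂ r) = toL (splitAt ℓ r)

  to : Fin (order κ ℓ μ) → V
  to zero    = X
  to (suc r) = toK (splitAt (suc κ) r)

  to∘from : ∀ v → to (from v) ≡ v
  to∘from X = refl
  to∘from (K a) rewrite splitAt-↑ˡ (suc κ) a (ℓ + (suc μ + suc μ)) = refl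
  to∘from (L l)
    rewrite splitAt-↑ʳ (suc κ) (ℓ + (suc μ + suc μ)) (l ↑ˡ (suc μ + suc μ))
          | splitAt-↑ˡ ℓ l (suc μ + suc μ) = refl
  to∘from (Le i)
    rewrite splitAt-↑ʳ (suc κ) (ℓ + (suc μ + suc μ)) (ℓ ↑ʳ (i ↑ˡ suc μ))
          | splitAt-↑ʳ ℓ (suc μ + suc μ) (i ↑ˡ suc μ)
          | splitAt-↑ˡ (suc μ) i (suc μ) = refl
  to∘from (Ri j)
    rewrite splitAt-↑ʳ (suc κ) (ℓ + (suc μ + suc μ)) (ℓ ↑ʳ (suc μ ↑ʳ j))
          | splitAt-↑ʳ ℓ (suc μ + suc μ) (suc μ ↑ʳ j)
          | splitAt-↑ʳ (suc μ) (suc μ) j = refl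

  from∘to : ∀ r → from (to r) ≡ r
  from∘to zero = refl
  from∘to (suc r) with splitAt (suc κ) r in e
  ... | inj₁ a = cong suc (splitAt⁻¹-↑ˡ e)
  ... | inj₂ r′ with splitAt ℓ r′ in e′
  ...   | inj₁ l = cong suc (trans (cong (suc κ ↑ʳ_) (splitAt⁻¹-↑ˡ e′)) (splitAt⁻¹-↑ʳ {i = r} e))
  ...   | inj₂ r″ with splitAt (suc μ) r″ in e″
  ...     | inj₁ i = cong suc (trans (cong (λ s → suc κ ↑ʳ (ℓ ↑ʳ s)) (splitAt⁻¹-↑ˡ e″))
                       (trans (cong (suc κ ↑ʳ_) (splitAt⁻¹-↑ʳ {m = ℓ} e′)) (splitAt⁻¹-↑ʳ {i = r} e)))
  ...     | inj₂ j = cong suc (trans (cong (λ s → suc κ ↑ʳ (ℓ ↑ʳ s)) (splitAt⁻¹-↑ʳ {i = r″} e″))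
                       (trans (cong (suc κ ↑ʳ_) (splitAt⁻¹-↑ʳ {m = ℓ} e′)) (splitAt⁻¹-↑ʳ {i = r} e)))

  V-enum : Fin (order κ ℓ μ) ↔ V
  V-enum = mk↔ₛ′ to from to∘from from∘to

  open Counting V-enum

  sum-V : ∀ (f : V → ℕ) → sum (f ∘ to) ≡
    f X + (sum (f ∘ K) + (sum (f ∘ L) + (sum (f ∘ Le) + sum (f ∘ Ri))))
  sum-V f = cong (f X +_) (begin
    sum (f ∘ to ∘ suc)
      ≡⟨ sum-split (suc κ) (f ∘ to ∘ suc) ⟩
    sum (λ a → f (to (from (K a)))) + sum (λ r → f (to (suc (suc κ ↑ʳ r))))
      ≡⟨ cong₂ _+_ (block K) (begin
        sum (λ r → f (to (suc (suc κ ↑ʳ r))))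
          ≡⟨ sum-split ℓ (λ r → f (to (suc (suc κ ↑ʳ r)))) ⟩
        sum (λ l → f (to (from (L l)))) + sum (λ r → f (to (suc (suc κ ↑ʳ (ℓ ↑ʳ r)))))
          ≡⟨ cong₂ _+_ (block L) (begin
            sum (λ r → f (to (suc (suc κ ↑ʳ (ℓ ↑ʳ r)))))
              ≡⟨ sum-split (suc μ) (λ r → f (to (suc (suc κ ↑ʳ (ℓ ↑ʳ r))))) ⟩
            sum (λ i → f (to (from (Le i)))) + sum (λ j → f (to (from (Ri j))))
              ≡⟨ cong₂ _+_ (block Le) (block Ri) ⟩
            sum (f ∘ Le) + sum (f ∘ Ri) ∎) ⟩
        sum (f ∘ L) + (sum (f ∘ Le) + sum (f ∘ Ri)) ∎) ⟩
    sum (f ∘ K) + (sum (f ∘ L) + (sum (f ∘ Le) + sum (f ∘ Ri))) ∎)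
    where
    open ≡-Reasoning
    block : ∀ {n} (g : Fin n → V) → sum (λ i → f (to (from (g i)))) ≡ sum (f ∘ g)
    block g = sum-cong-≗ λ i → cong f (to∘from (g i))

  count-V : ∀ p → count p ≡
    [ p X ] + (sum ([_] ∘ p ∘ K) + (sum ([_] ∘ p ∘ L) + (sum ([_] ∘ p ∘ Le) + sum ([_] ∘ p ∘ Ri))))
  count-V p = sum-V ([_] ∘ p)

  small : Fin (suc κ) → Bool
  small a = toℕ a <ᵇ κ

  isZero : Fin (suc μ) → Bool
  isZero zero    = true
  isZero (suc _) = false

  -- A circulant bipartite graph: the residue of `toℕ i + toℕ j` modulo `suc μ` must be one of the
  -- `suc κ` consecutive residues that start at `μ`. The two windows stand for the two possible
  -- representatives. Starting at `μ` puts the red matching `toℕ i + toℕ j ≡ μ` at the first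
  -- residue.
  rim : Fin (suc μ) → Fin (suc μ) → Bool
  rim i j = window μ (suc κ) (toℕ i + toℕ j) ∨ window μ (suc κ) (toℕ i + (suc μ + toℕ j))

  adjV : V → V → Bool
  adjV X      (K a)  = small a
  adjV X      (Le _) = true
  adjV X      (Ri _) = true
  adjV (K a)  X      = small a
  adjV (K a)  (K b)  = inner a b
  adjV (K a)  (L l)  = outer a l
  adjV (K _)  (Le i) = isZero i
  adjV (L l)  (K a)  = outer a l
  adjV (L l)  (L l′) = not ⌊ l ≟ l′ ⌋
  adjV (L _)  (Le i) = isZero i
  adjV (Le _) X      = true
  adjV (Le i) (K _)  = isZero i
  adjV (Le i) (L _)  = isZero i
  adjV (Le i) (Ri j) = rim i j
  adjV (Ri _) X      = true
  adjV (Ri j) (Le i) = rim i j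
  adjV _      _      = false

  adjV-sym : ∀ v w → adjV v w ≡ adjV w v
  adjV-sym X      X      = refl
  adjV-sym X      (K a)  = refl
  adjV-sym X      (L l)  = refl
  adjV-sym X      (Le i) = refl
  adjV-sym X      (Ri j) = refl
  adjV-sym (K a)  X      = refl
  adjV-sym (K a)  (K b)  = inner-sym a b
  adjV-sym (K a)  (L l)  = refl
  adjV-sym (K a)  (Le i) = refl
  adjV-sym (K a)  (Ri j) = refl
  adjV-sym (L l)  X      = refl
  adjV-sym (L l)  (K a)  = refl
  adjV-sym (L l)  (L l′) = cong not (isYes-sym l l′)
  adjV-sym (L l)  (Le i) = refl
  adjV-sym (L l)  (Ri j) = refl
  adjV-sym (Le i) X      = refl
  adjV-sym (Le i) (K a)  = refl
  adjV-sym (Le i) (L l)  = refl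
  adjV-sym (Le i) (Le j) = refl
  adjV-sym (Le i) (Ri j) = refl
  adjV-sym (Ri j) X      = refl
  adjV-sym (Ri j) (K a)  = refl
  adjV-sym (Ri j) (L l)  = refl
  adjV-sym (Ri j) (Le i) = refl
  adjV-sym (Ri j) (Ri i) = refl

  adjV-irrefl : ∀ v → adjV v v ≡ false
  adjV-irrefl X      = refl
  adjV-irrefl (K a)  = inner-irrefl a
  adjV-irrefl (L l)  = cong not (isYes-refl l)
  adjV-irrefl (Le i) = refl
  adjV-irrefl (Ri j) = refl

  rim-sym : ∀ i j → rim i j ≡ rim j i
  rim-sym i j = cong₂ (λ s t → window μ (suc κ) s ∨ window μ (suc κ) t)
    (+-comm (toℕ i) (toℕ j))
    (trans (+-comm (toℕ i) _) (trans (cong (_+ toℕ i) (+-comm (suc μ) (toℕ j))) (+-assoc (toℕ j) (suc μ) (toℕ i))))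

  -- The two windows are disjoint since `κ ≤ μ`. Their counts over `j` join into one count over an
  -- interval of length `suc μ + suc μ`, which contains the whole window.
  sum-rim : ∀ i → sum (λ j → [ rim i j ]) ≡ suc κ
  sum-rim i = begin
    sum {suc μ} (λ j → [ rim i j ])
      ≡⟨ sum-cong-≗ {suc μ} disjoint ⟩
    sum {suc μ} (λ j → [ w (toℕ i + toℕ j) ] + [ w (toℕ i + (suc μ + toℕ j)) ])
      ≡⟨ ∑-distrib-+ {suc μ} (λ j → [ w (toℕ i + toℕ j) ]) (λ j → [ w (toℕ i + (suc μ + toℕ j)) ]) ⟩
    sum {suc μ} (λ j → [ w (toℕ i + toℕ j) ]) + sum {suc μ} (λ j → [ w (toℕ i + (suc μ + toℕ j)) ])
      ≡⟨ cong₂ _+_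
           (sum-cong-≗ {suc μ} λ j → cong (λ t → [ w (toℕ i + t) ]) (toℕ-↑ˡ j (suc μ)))
           (sum-cong-≗ {suc μ} λ j → cong (λ t → [ w (toℕ i + t) ]) (toℕ-↑ʳ (suc μ) j)) ⟨
    sum {suc μ} (λ j → [ w (toℕ i + toℕ (j ↑ˡ suc μ)) ]) + sum {suc μ} (λ j → [ w (toℕ i + toℕ (suc μ ↑ʳ j)) ])
      ≡⟨ sum-split (suc μ) {suc μ} (λ t → [ w (toℕ i + toℕ t) ]) ⟨
    sum {suc μ + suc μ} (λ t → [ w (toℕ i + toℕ t) ])
      ≡⟨ sum-window (toℕ i) μ (suc κ) (toℕ≤pred[n] i)
           (≤-trans (+-mono-≤ (n≤1+n μ) (s≤s κ≤μ)) (m≤n+m _ (toℕ i))) ⟩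
    suc κ ∎
    where
    open ≡-Reasoning
    w = window μ (suc κ)
    disjoint : ∀ j → [ rim i j ] ≡ [ w (toℕ i + toℕ j) ] + [ w (toℕ i + (suc μ + toℕ j)) ]
    disjoint j with w (toℕ i + toℕ j) in e | w (toℕ i + (suc μ + toℕ j)) in e′
    ... | false | _     = refl
    ... | true  | false = refl
    -- If both held, `s + suc μ` would be below `μ + suc κ`, so `s < κ ≤ μ`, and `s` would lie below
    -- its window.
    ... | true  | true  = ⊥-elim (true≢false (<ᵇ-true s<μ) (not-false (∧-conicalˡ _ _ e)))
      where
      s = toℕ i + toℕ j
      s<μ : s < μ
      s<μ = <-≤-trans (+-cancelʳ-< (suc μ) s (suc κ ∸ 1)
        (subst₂ _<_ (trans (cong (toℕ i +_) (+-comm (suc μ) (toℕ j))) (sym (+-assoc (toℕ i) _ _)))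
           (trans (+-comm μ (suc κ)) (sym (+-suc κ μ)))
          (<ᵇ⇒<′ _ _ (∧-conicalʳ _ _ e′)))) κ≤μ

  sum-rimᵗ : ∀ j → sum (λ i → [ rim i j ]) ≡ suc κ
  sum-rimᵗ j = trans (sum-cong-≗ λ i → cong [_] (rim-sym i j)) (sum-rim j)

  sum-isZero : sum ([_] ∘ isZero) ≡ 1
  sum-isZero = cong suc (sum-zero {μ} λ _ → refl)

  sum-small : sum ([_] ∘ small) ≡ κ
  sum-small = sum-below κ (n≤1+n κ)

  zeros : ∀ n → sum {n} (λ _ → 0) ≡ 0
  zeros n = sum-zero {n} λ _ → refl

  ones : ∀ n → sum {n} (λ _ → 1) ≡ n
  ones n = trans (sum-const n 1) (*-identityʳ n)

  deg-X : count (adjV X) ≡ κ + (suc μ + suc μ)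
  deg-X = begin
    count (adjV X)                        ≡⟨ count-V (adjV X) ⟩
    _                                     ≡⟨ cong₂ _+_ sum-small (cong₂ _+_ (zeros ℓ) (cong₂ _+_ (ones (suc μ)) (ones (suc μ)))) ⟩
    κ + (suc μ + suc μ)                   ∎
    where open ≡-Reasoning

  deg-K : ∀ a → count (adjV (K a)) ≡ suc (suc κ)
  deg-K a = begin
    count (adjV (K a))                    ≡⟨ count-V (adjV (K a)) ⟩
    [ small a ] + (s + (t + (sum ([_] ∘ isZero) + sum {suc μ} (λ _ → 0))))
                                          ≡⟨ cong (λ z → [ small a ] + (s + (t + z))) (cong₂ _+_ sum-isZero (zeros (suc μ))) ⟩
    [ small a ] + (s + (t + 1))           ≡⟨ cong ([ small a ] +_) (+-assoc s t 1) ⟨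
    [ small a ] + (s + t + 1)             ≡⟨ +-assoc [ small a ] (s + t) 1 ⟨
    [ small a ] + (s + t) + 1             ≡⟨ cong (_+ 1) (degree a) ⟩
    suc κ + 1                             ≡⟨ +-comm (suc κ) 1 ⟩
    suc (suc κ)                           ∎
    where
    open ≡-Reasoning
    s = sum (λ b → [ inner a b ])
    t = sum (λ l → [ outer a l ])

  deg-L : ∀ l → count (adjV (L l)) ≡ sum (λ a → [ outer a l ]) + ℓ
  deg-L l = begin
    count (adjV (L l))                    ≡⟨ count-V (adjV (L l)) ⟩
    s + (t + (sum ([_] ∘ isZero) + sum {suc μ} (λ _ → 0)))
                                          ≡⟨ cong (λ z → s + (t + z)) (cong₂ _+_ sum-isZero (zeros (suc μ))) ⟩
    s + (t + 1)                           ≡⟨ cong (s +_) (+-comm t 1) ⟩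
    s + (1 + t)                           ≡⟨ cong (λ z → s + (z + t)) (trans (sum-cong-≗ λ l′ → cong [_] (isYes-sym l l′)) (sum-≟ l)) ⟨
    s + (sum (λ l′ → [ ⌊ l ≟ l′ ⌋ ]) + t) ≡⟨ cong (s +_) (sum-not (λ l′ → ⌊ l ≟ l′ ⌋)) ⟩
    s + ℓ                                 ∎
    where
    open ≡-Reasoning
    s = sum (λ a → [ outer a l ])
    t = sum (λ l′ → [ not ⌊ l ≟ l′ ⌋ ])

  deg-Le : ∀ i → count (adjV (Le i)) ≡ suc ((suc κ + ℓ) * [ isZero i ] + suc κ)
  deg-Le i = trans (count-V (adjV (Le i))) (cong suc (begin
    sum {suc κ} (λ _ → [ isZero i ]) + (sum {ℓ} (λ _ → [ isZero i ]) + (sum {suc μ} (λ _ → 0) + sum (λ j → [ rim i j ])))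
      ≡⟨ cong₂ _+_ (sum-const (suc κ) [ isZero i ])
           (cong₂ _+_ (sum-const ℓ [ isZero i ]) (cong₂ _+_ (zeros (suc μ)) (sum-rim i))) ⟩
    suc κ * [ isZero i ] + (ℓ * [ isZero i ] + suc κ)
      ≡⟨ +-assoc (suc κ * [ isZero i ]) _ _ ⟨
    suc κ * [ isZero i ] + ℓ * [ isZero i ] + suc κ
      ≡⟨ cong (_+ suc κ) (*-distribʳ-+ [ isZero i ] (suc κ) ℓ) ⟨
    (suc κ + ℓ) * [ isZero i ] + suc κ ∎))
    where open ≡-Reasoning

  deg-Ri : ∀ j → count (adjV (Ri j)) ≡ suc (suc κ)
  deg-Ri j = trans (count-V (adjV (Ri j))) (cong suc (cong₂ _+_ (zeros (suc κ))
    (cong₂ _+_ (zeros ℓ) (trans (cong₂ _+_ (sum-rimᵗ j) (zeros (suc μ))) (+-identityʳ _)))))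

  r₀ : V
  r₀ = Le zero

  -- The core is split by adjacency to `X`: the `κ` neighbours of `X` are `near`, the other `suc ℓ`
  -- vertices are `far`.
  far : V → Bool
  far (K a) = not (small a)
  far (L _) = true
  far _     = false

  near : V → Bool
  near (K a) = small a
  near _     = false

  count-near : count near ≡ κ
  count-near = trans (count-V near) (trans (cong₂ _+_ sum-small
    (cong₂ _+_ (zeros ℓ) (cong₂ _+_ (zeros (suc μ)) (zeros (suc μ))))) (+-identityʳ κ))

  count-far : count far ≡ suc ℓ
  count-far = trans (count-V far) (cong₂ _+_
    (+-cancelˡ-≡ κ _ _ (trans (cong (_+ sum (λ a → [ not (small a) ])) (sym sum-small))
      (trans (sum-not small) (+-comm 1 κ))))
    (trans (cong₂ _+_ (ones ℓ) (cong₂ _+_ (zeros (suc μ)) (zeros (suc μ)))) (+-identityʳ ℓ)))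

  X-nonadj : ∀ w → adjV X w ≡ false → w ≡ X ⊎ far w ≡ true
  X-nonadj X      _ = inj₁ refl
  X-nonadj (K a)  e = inj₂ (cong not e)
  X-nonadj (L l)  _ = inj₂ refl

  -- The right side is arranged for the counting argument: `κ` bounds the blue edges at `r₀`, and
  -- the remaining four summands bound the four classes of its red neighbours.
  deg-r₀ : count (adjV r₀) ≡ κ + (1 + (1 + (κ + suc ℓ)))
  deg-r₀ = trans (trans (deg-Le zero) (cong suc (begin
    (suc κ + ℓ) * 1 + suc κ        ≡⟨ cong (_+ suc κ) (*-identityʳ (suc κ + ℓ)) ⟩
    suc κ + ℓ + suc κ              ≡⟨ +-comm (suc κ + ℓ) (suc κ) ⟩
    suc (κ + suc (κ + ℓ))          ≡⟨ +-suc κ _ ⟨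
    κ + suc (suc (κ + ℓ))          ≡⟨ cong (λ z → κ + suc z) (+-suc κ ℓ) ⟨
    κ + suc (κ + suc ℓ)            ∎))) (sym (+-suc κ _))
    where
    open ≡-Reasoning

  -- Critical colourings of the graph with one edge added

  module Forcing
    (u v : V) (u≢v : u ≢ v) (u≁v : adjV u v ≡ false)
    -- `A` is the adjacency with the new edge included and `R` its red part. Criticality enters only
    -- through `blue≤κ` and `no-C₄`.
    (A R : V → V → Bool)
    (adj⇒A   : ∀ {a b} → adjV a b ≡ true → A a b ≡ true)
    (A-uv    : A u v ≡ true)
    (A-vu    : A v u ≡ true)
    (A⇒adj   : ∀ {a b} → A a b ≡ true → adjV a b ≡ true ⊎ (a ≡ u × b ≡ v) ⊎ (a ≡ v × b ≡ u))
    (R⇒A     : ∀ {a b} → R a b ≡ true → A a b ≡ true)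
    (R-sym   : ∀ {a b} → R a b ≡ true → R b a ≡ true)
    (blue≤κ  : ∀ a → count (λ b → A a b ∧ not (R a b)) ≤ κ)
    (no-C₄   : ∀ {a b c d} → a ≢ c → b ≢ d → R a b ≡ true → R b c ≡ true →
               R c d ≡ true → R d a ≡ true → ⊥)
    where

    blueA : V → V → Bool
    blueA a b = A a b ∧ not (R a b)

    -- Unlike in `degree≤`, the red edges counted here belong to the original graph, so a red
    -- neighbour found this way does not come from the new edge.
    old-degree≤ : ∀ a → count (adjV a) ≤ count (λ b → adjV a b ∧ R a b) + κ
    old-degree≤ a = begin
      count (adjV a)                                        ≡⟨ count-partition (adjV a) (R a) ⟩
      count redOld + count (λ b → adjV a b ∧ not (R a b))   ≤⟨ +-monoʳ-≤ (count redOld) (count-mono {λ b → adjV a b ∧ not (R a b)} {blueA a} old-blue) ⟩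
      count redOld + count (blueA a)                        ≤⟨ +-monoʳ-≤ (count redOld) (blue≤κ a) ⟩
      count redOld + κ                                      ∎
      where
      open ≤-Reasoning
      redOld : V → Bool
      redOld b = adjV a b ∧ R a b
      old-blue : ∀ b → adjV a b ∧ not (R a b) ≡ true → blueA a b ≡ true
      old-blue b e = ∧-true (adj⇒A (∧-conicalˡ (adjV a b) _ e)) (∧-conicalʳ (adjV a b) _ e)

    A-degree≤ : ∀ a → count (A a) ≤ count (R a) + κ
    A-degree≤ a = ≤-trans (count-∨ {A a} {R a} {blueA a} cover) (+-monoʳ-≤ (count (R a)) (blue≤κ a))
      where
      cover : ∀ b → A a b ≡ true → R a b ≡ true ⊎ blueA a b ≡ true
      cover b e with bool-cases (R a b)
      ... | inj₁ r  = inj₁ r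
      ... | inj₂ ¬r = inj₂ (∧-true e (cong not ¬r))

    -- An end of the new edge gains one in degree, while blue still accounts for at most `κ` of the
    -- total.
    new-degree≤ : ∀ a b → A a b ≡ true → adjV a b ≡ false → suc (count (adjV a)) ≤ count (R a) + κ
    new-degree≤ a b e ¬e = ≤-trans (count-strict {adjV a} {A a} (λ c → adj⇒A) b ¬e e) (A-degree≤ a)

    degree≤ : ∀ a → count (adjV a) ≤ count (R a) + κ
    degree≤ a = ≤-trans (count-mono {adjV a} {A a} (λ c → adj⇒A)) (A-degree≤ a)

    -- These four sets have at most 1, 1, κ and ℓ + 1 elements, while r₀ has at least
    -- κ + ℓ + 3 red neighbours, so that all four bounds are attained.
    via-X via-red via-blue via-far : V → Bool
    via-X    w = R r₀ w ∧ (w == X)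
    via-red  w = R r₀ w ∧ R X w
    via-blue w = R r₀ w ∧ blueA X w
    via-far  w = R r₀ w ∧ (far w ∧ not (A X w))

    -- A vertex other than `X` is joined to `X` in red, in blue, or not at all; in the last case it
    -- was not adjacent to `X` before either, hence it is `far`.
    red-r₀-cover : count (R r₀) ≤ count via-X + (count via-red + (count via-blue + count via-far))
    red-r₀-cover = begin
      count (R r₀)                                     ≤⟨ count-∨ {R r₀} {via-X} {p₁} cover₁ ⟩
      count via-X + count p₁                           ≤⟨ +-monoʳ-≤ (count via-X) (count-∨ {p₁} {via-red} {p₂} cover₂) ⟩
      count via-X + (count via-red + count p₂)         ≤⟨ +-monoʳ-≤ (count via-X) (+-monoʳ-≤ (count via-red) (count-∨ {p₂} {via-blue} {via-far} cover₃)) ⟩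
      _                                                ∎
      where
      open ≤-Reasoning
      p₁ p₂ : V → Bool
      p₁ w = R r₀ w ∧ not (w == X)
      p₂ w = p₁ w ∧ not (R X w)
      cover₁ : ∀ w → R r₀ w ≡ true → via-X w ≡ true ⊎ p₁ w ≡ true
      cover₁ w e with bool-cases (w == X)
      ... | inj₁ t = inj₁ (∧-true e t)
      ... | inj₂ f = inj₂ (∧-true e (cong not f))
      cover₂ : ∀ w → p₁ w ≡ true → via-red w ≡ true ⊎ p₂ w ≡ true
      cover₂ w e with bool-cases (R X w)
      ... | inj₁ t = inj₁ (∧-true (∧-conicalˡ (R r₀ w) _ e) t)
      ... | inj₂ f = inj₂ (∧-true e (cong not f))
      cover₃ : ∀ w → p₂ w ≡ true → via-blue w ≡ true ⊎ via-far w ≡ true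
      cover₃ w e with bool-cases (A X w)
      ... | inj₁ t = inj₁ (∧-true (∧-conicalˡ (R r₀ w) _ (∧-conicalˡ (p₁ w) _ e)) (∧-true t (∧-conicalʳ (p₁ w) _ e)))
      ... | inj₂ f with bool-cases (adjV X w)
      ...   | inj₁ adj = ⊥-elim (true≢false (adj⇒A adj) f)
      ...   | inj₂ ¬adj with X-nonadj w ¬adj
      ...     | inj₁ refl = ⊥-elim (true≢false (==-refl X) (not-false (∧-conicalʳ (R r₀ X) _ (∧-conicalˡ (p₁ X) _ e))))
      ...     | inj₂ fw   = inj₂ (∧-true (∧-conicalˡ (R r₀ w) _ (∧-conicalˡ (p₁ w) _ e)) (∧-true fw (cong not f)))

    via-X⊆ : ∀ w → via-X w ≡ true → w == X ≡ true
    via-X⊆ w = ∧-conicalʳ (R r₀ w) _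

    via-blue⊆ : ∀ w → via-blue w ≡ true → blueA X w ≡ true
    via-blue⊆ w = ∧-conicalʳ (R r₀ w) _

    via-far⊆ : ∀ w → via-far w ≡ true → far w ≡ true
    via-far⊆ w e = ∧-conicalˡ (far w) _ (∧-conicalʳ (R r₀ w) _ e)

    via-X≤1 : count via-X ≤ 1
    via-X≤1 = ≤-trans (count-mono {via-X} {_== X} via-X⊆) (≤-reflexive (count-== X))

    -- Two common red neighbours of `r₀` and `X` would close a red C₄.
    via-red≤1 : count via-red ≤ 1
    via-red≤1 = count-≤1 {via-red} unique
      where
      unique : ∀ a b → via-red a ≡ true → via-red b ≡ true → a ≡ b
      unique a b e f with bool-cases (a == b)
      ... | inj₁ a==b = ==⇒≡ a b a==b
      ... | inj₂ a≠b  = ⊥-elim (no-C₄ {r₀} {a} {X} {b} (λ ()) (λ { refl → true≢false (==-refl a) a≠b })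
              (∧-conicalˡ (R r₀ a) _ e) (R-sym (∧-conicalʳ (R r₀ a) _ e)) (∧-conicalʳ (R r₀ b) _ f) (R-sym (∧-conicalˡ (R r₀ b) _ f)))

    via-blue≤κ : count via-blue ≤ κ
    via-blue≤κ = ≤-trans (count-mono {via-blue} {blueA X} via-blue⊆) (blue≤κ X)

    via-far≤ : count via-far ≤ suc ℓ
    via-far≤ = ≤-trans (count-mono {via-far} {far} via-far⊆) (≤-reflexive count-far)

    red-r₀≤ : count (R r₀) ≤ 1 + (1 + (κ + suc ℓ))
    red-r₀≤ = ≤-trans red-r₀-cover (+-mono-≤ via-X≤1 (+-mono-≤ via-red≤1 (+-mono-≤ via-blue≤κ via-far≤)))

    red-r₀≥ : 1 + (1 + (κ + suc ℓ)) ≤ count (R r₀)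
    red-r₀≥ = +-cancelˡ-≤ κ _ _ (≤-trans (≤-reflexive (sym deg-r₀))
                (≤-trans (degree≤ r₀) (≤-reflexive (+-comm (count (R r₀)) κ))))

    -- The upper bound on the red degree of `r₀` equals the lower bound, so `tight` applies, first
    -- to `via-X` and afterwards to the rest.
    via-X-full : 1 ≤ count via-X × 1 + (κ + suc ℓ) ≤ count via-red + (count via-blue + count via-far)
    via-X-full = tight via-X≤1 (+-mono-≤ via-red≤1 (+-mono-≤ via-blue≤κ via-far≤)) (≤-trans red-r₀≥ red-r₀-cover)

    via-blue-far-full : κ ≤ count via-blue × suc ℓ ≤ count via-far
    via-blue-far-full = tight via-blue≤κ via-far≤
      (proj₂ (tight via-red≤1 (+-mono-≤ via-blue≤κ via-far≤) (proj₂ via-X-full)))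

    r₀-X-red : R r₀ X ≡ true
    r₀-X-red = ∧-conicalˡ (R r₀ X) _ (count-full {via-X} {_== X} via-X⊆
      (≤-trans (≤-reflexive (count-== X)) (proj₁ via-X-full)) X (==-refl X))

    X-r₀-red : R X r₀ ≡ true
    X-r₀-red = R-sym r₀-X-red

    blue-X⇒red-r₀ : ∀ w → blueA X w ≡ true → R r₀ w ≡ true
    blue-X⇒red-r₀ w e = ∧-conicalˡ (R r₀ w) _ (count-full {via-blue} {blueA X} via-blue⊆
      (≤-trans (blue≤κ X) (proj₁ via-blue-far-full)) w e)

    far⇒ : ∀ w → far w ≡ true → via-far w ≡ true
    far⇒ w e = count-full {via-far} {far} via-far⊆
      (≤-trans (≤-reflexive count-far) (proj₂ via-blue-far-full)) w e

    far⇒red-r₀ : ∀ w → far w ≡ true → R r₀ w ≡ true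
    far⇒red-r₀ w e = ∧-conicalˡ (R r₀ w) _ (far⇒ w e)

    far⇒¬A-X : ∀ w → far w ≡ true → A X w ≡ false
    far⇒¬A-X w e = not-false (∧-conicalʳ (far w) _ (∧-conicalʳ (R r₀ w) _ (far⇒ w e)))

    -- The only candidates for a new neighbour of `X` are the `far` vertices, and none of them is
    -- joined to `X`. So the new edge avoids `X`.
    A-X⇒adj : ∀ w → X ≢ w → A X w ≡ true → adjV X w ≡ true
    A-X⇒adj w X≢w e = ¬-not λ ¬adj → case (X-nonadj w ¬adj)
      where
      case : w ≡ X ⊎ far w ≡ true → ⊥
      case (inj₁ refl) = X≢w refl
      case (inj₂ fw)   = true≢false e (far⇒¬A-X w fw)

    -- The new edge also avoids `r₀`: the old degree of `r₀` already exhausts its maximal red degree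
    -- and `κ` blue edges, leaving no room for one more.
    A-r₀⇒adj : ∀ w → A r₀ w ≡ true → adjV r₀ w ≡ true
    A-r₀⇒adj w e = ¬-not λ ¬adj → 1+n≰n (begin
      suc (κ + (1 + (1 + (κ + suc ℓ))))   ≡⟨ cong suc deg-r₀ ⟨
      suc (count (adjV r₀))               ≤⟨ new-degree≤ r₀ w e ¬adj ⟩
      count (R r₀) + κ                    ≤⟨ +-monoˡ-≤ κ red-r₀≤ ⟩
      1 + (1 + (κ + suc ℓ)) + κ           ≡⟨ +-comm _ κ ⟩
      κ + (1 + (1 + (κ + suc ℓ)))         ∎)
      where open ≤-Reasoning

    -- A blue neighbour of `X` is red to `r₀`, hence an old neighbour of `r₀`. This rules out the
    -- other left vertices at once; right vertices need a separate argument.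
    blue-X⊆near : ∀ w → blueA X w ≡ true → near w ≡ true
    blue-X⊆near w e = go w e (A-r₀⇒adj w (R⇒A (blue-X⇒red-r₀ w e)))
      where
      go : ∀ w → blueA X w ≡ true → adjV r₀ w ≡ true → near w ≡ true
      go X     e _ with A⇒adj (∧-conicalˡ (A X X) _ e)
      ... | inj₂ (inj₁ (refl , refl)) = contradiction refl u≢v
      ... | inj₂ (inj₂ (refl , refl)) = contradiction refl u≢v
      go (K a) e _ = A-X⇒adj (K a) (λ ()) (∧-conicalˡ (A X (K a)) _ e)
      go (L l) e _ = ⊥-elim (true≢false (∧-conicalˡ (A X (L l)) _ e) (far⇒¬A-X (L l) refl))
      -- The right vertex Ri j has a red neighbour y besides r₀ that is not due to the new edge;
      -- y is a left vertex, red to X (a red C₄ through r₀) or blue to X (hence adjacent to r₀).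
      go (Ri j) e _ = ⊥-elim (contradict (count-∃≢ (λ y → adjV (Ri j) y ∧ R (Ri j) y) r₀
          (+-cancelʳ-≤ κ 2 _ (≤-trans (≤-reflexive (sym (deg-Ri j))) (old-degree≤ (Ri j))))))
        where
        left : ∀ i → R (Ri j) (Le i) ≡ true → Le i ≢ r₀ → R X (Le i) ≡ true ⊎ R X (Le i) ≡ false → ⊥
        left i r y≢r₀ (inj₁ t) = no-C₄ {X} {r₀} {Ri j} {Le i} (λ ()) (λ r₀≡y → y≢r₀ (sym r₀≡y))
                                   X-r₀-red (blue-X⇒red-r₀ (Ri j) e) r (R-sym t)
        left i r y≢r₀ (inj₂ f) = true≢false (A-r₀⇒adj (Le i) (R⇒A (blue-X⇒red-r₀ (Le i)
                                   (∧-true (adj⇒A refl) (cong not f))))) refl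
        contradict : (∃ λ y → adjV (Ri j) y ∧ R (Ri j) y ≡ true × y ≢ r₀) → ⊥
        contradict (X    , r , _)    = true≢false (R-sym r) (not-false (∧-conicalʳ (A X (Ri j)) _ e))
        contradict (Le i , r , y≢r₀) = left i (∧-conicalʳ (rim i j) _ r) y≢r₀ (bool-cases (R X (Le i)))

    -- The blue neighbourhood of `X` has at least `κ` elements and lies in `near`, which has exactly
    -- `κ`.
    near⇒blue-X : ∀ w → near w ≡ true → blueA X w ≡ true
    near⇒blue-X = count-full {blueA X} {near} blue-X⊆near
      (≤-trans (≤-reflexive count-near)
        (≤-trans (proj₁ via-blue-far-full) (count-mono {via-blue} {blueA X} via-blue⊆)))

    Core-like : V → Set
    Core-like w = R r₀ w ≡ true × R X w ≡ false

    near⇒core : ∀ w → near w ≡ true → Core-like w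
    near⇒core w e = blue-X⇒red-r₀ w (near⇒blue-X w e) , not-false (∧-conicalʳ (A X w) _ (near⇒blue-X w e))

    far⇒core : ∀ w → far w ≡ true → Core-like w
    far⇒core w e = far⇒red-r₀ w e , ¬-not λ r → true≢false (R⇒A r) (far⇒¬A-X w e)

    rim⇒red-X : ∀ w → adjV X w ≡ true → near w ≡ false → R X w ≡ true
    rim⇒red-X w adj ¬near with bool-cases (R X w)
    ... | inj₁ t = t
    ... | inj₂ f = ⊥-elim (true≢false (blue-X⊆near w (∧-true (adj⇒A adj) (cong not f))) ¬near)

    -- Every vertex but `X` thus has a red edge to one of the adjacent hubs `X` and `r₀`; these are
    -- the edges that close the red C₄ in `red≤2`.
    classify : ∀ w → w ≢ X → R X w ≡ true ⊎ Core-like w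
    classify X      w≢X = contradiction refl w≢X
    classify (K a)  _ with bool-cases (small a)
    ... | inj₁ t = inj₂ (near⇒core (K a) t)
    ... | inj₂ f = inj₂ (far⇒core (K a) (cong not f))
    classify (L l)  _ = inj₂ (far⇒core (L l) refl)
    classify (Le i) _ = inj₁ (rim⇒red-X (Le i) refl refl)
    classify (Ri j) _ = inj₁ (rim⇒red-X (Ri j) refl refl)

    -- With three red neighbours, `w` has two, `y` and `z`, besides its own hub. If one of them is
    -- red to the other hub, the red edge between `X` and `r₀` completes a C₄; otherwise `w`, `y`,
    -- `z` and the hub of `w` form one.
    red≤2 : ∀ w → w ≢ X → w ≢ r₀ → count (R w) ≤ 2
    red≤2 w w≢X w≢r₀ = ≮⇒≥ (contradict (classify w w≢X))
      where
      contradict : R X w ≡ true ⊎ Core-like w → 2 < count (R w) → ⊥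
      contradict (inj₁ Xw) 2<
        with y , z , (wy , y≢X) , (wz , z≢X) , y≢z ← count-∃₂≢ (R w) X 2<
        with classify y y≢X | classify z z≢X
      ... | inj₂ (r₀y , _) | _              = no-C₄ (λ X≡y → y≢X (sym X≡y)) w≢r₀ Xw wy (R-sym r₀y) r₀-X-red
      ... | inj₁ _         | inj₂ (r₀z , _) = no-C₄ (λ X≡z → z≢X (sym X≡z)) w≢r₀ Xw wz (R-sym r₀z) r₀-X-red
      ... | inj₁ Xy        | inj₁ Xz        = no-C₄ (λ X≡w → w≢X (sym X≡w)) y≢z Xy (R-sym wy) wz (R-sym Xz)
      contradict (inj₂ (r₀w , ¬Xw)) 2<
        with y , z , (wy , y≢r₀) , (wz , z≢r₀) , y≢z ← count-∃₂≢ (R w) r₀ 2<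
        with classify y (λ { refl → true≢false (R-sym wy) ¬Xw }) | classify z (λ { refl → true≢false (R-sym wz) ¬Xw })
      ... | inj₁ Xy        | _              = no-C₄ w≢X y≢r₀ wy (R-sym Xy) X-r₀-red r₀w
      ... | inj₂ _         | inj₁ Xz        = no-C₄ w≢X z≢r₀ wz (R-sym Xz) X-r₀-red r₀w
      ... | inj₂ (r₀y , _) | inj₂ (r₀z , _) = no-C₄ (λ r₀≡w → w≢r₀ (sym r₀≡w)) y≢z r₀y (R-sym wy) wz (R-sym r₀z)

    -- The end `w` of the new edge would reach degree `κ + 3`, more than two red and `κ` blue edges
    -- can provide.
    saturated : ∀ w w′ → w ≢ w′ → A w w′ ≡ true → adjV w w′ ≡ false → suc (suc κ) ≤ count (adjV w) → ⊥
    saturated w w′ w≢w′ e ¬adj full = 1+n≰n (begin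
      suc (suc (suc κ))       ≤⟨ s≤s full ⟩
      suc (count (adjV w))    ≤⟨ new-degree≤ w w′ e ¬adj ⟩
      count (R w) + κ         ≤⟨ +-monoˡ-≤ κ (red≤2 w
                                   (λ { refl → true≢false (A-X⇒adj w′ w≢w′ e) ¬adj })
                                   (λ { refl → true≢false (A-r₀⇒adj w′ e) ¬adj })) ⟩
      suc (suc κ)             ∎)
      where open ≤-Reasoning

    full-degree : ∀ w → suc (suc κ) ≤ count (adjV w) ⊎ ∃ λ l → w ≡ L l
    full-degree X      = inj₁ (subst (suc (suc κ) ≤_) (sym deg-X)
      (≤-trans (≤-reflexive (+-comm 2 κ)) (+-monoʳ-≤ κ (s≤s (≤-trans (s≤s z≤n) (m≤n+m (suc μ) μ))))))
    full-degree (K a)  = inj₁ (≤-reflexive (sym (deg-K a)))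
    full-degree (L l)  = inj₂ (l , refl)
    full-degree (Le i) = inj₁ (subst (suc (suc κ) ≤_) (sym (deg-Le i)) (s≤s (m≤n+m (suc κ) _)))
    full-degree (Ri j) = inj₁ (≤-reflexive (sym (deg-Ri j)))

    -- Only vertices of `L` may lack the required degree, and `L` is a clique, so the new edge has
    -- an end outside `L`.
    absurd : ⊥
    absurd with full-degree u | full-degree v
    ... | inj₁ full      | _              = saturated u v u≢v A-uv u≁v full
    ... | inj₂ _         | inj₁ full      = saturated v u (λ v≡u → u≢v (sym v≡u)) A-vu (trans (adjV-sym v u) u≁v) full
    ... | inj₂ (l , refl) | inj₂ (l′ , refl) = u≢v (cong L (isYes-true l l′ (not-true u≁v)))

  -- A critical colouring of the graph

  redV : V → V → Bool
  redV X      (Le _) = true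
  redV X      (Ri _) = true
  redV (K a)  (K b)  = toℕ b ≡ᵇ partner (toℕ a)
  redV (K a)  (L l)  = suc κ + toℕ l ≡ᵇ partner (toℕ a)
  redV (K _)  (Le i) = isZero i
  redV (L l)  (K a)  = suc κ + toℕ l ≡ᵇ partner (toℕ a)
  redV (L l)  (L l′) = suc κ + toℕ l′ ≡ᵇ partner (suc κ + toℕ l)
  redV (L _)  (Le i) = isZero i
  redV (Le _) X      = true
  redV (Le i) (K _)  = isZero i
  redV (Le i) (L _)  = isZero i
  redV (Le i) (Ri j) = toℕ i + toℕ j ≡ᵇ μ
  redV (Ri _) X      = true
  redV (Ri j) (Le i) = toℕ i + toℕ j ≡ᵇ μ
  redV _      _      = false

  red-sym : ∀ v w → redV v w ≡ redV w v
  red-sym X      X      = refl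
  red-sym X      (K a)  = refl
  red-sym X      (L l)  = refl
  red-sym X      (Le i) = refl
  red-sym X      (Ri j) = refl
  red-sym (K a)  X      = refl
  red-sym (K a)  (K b)  = ≡ᵇ-partner-sym (toℕ b) (toℕ a)
  red-sym (K a)  (L l)  = refl
  red-sym (K a)  (Le i) = refl
  red-sym (K a)  (Ri j) = refl
  red-sym (L l)  X      = refl
  red-sym (L l)  (K a)  = refl
  red-sym (L l)  (L l′) = ≡ᵇ-partner-sym (suc κ + toℕ l′) (suc κ + toℕ l)
  red-sym (L l)  (Le i) = refl
  red-sym (L l)  (Ri j) = refl
  red-sym (Le i) X      = refl
  red-sym (Le i) (K a)  = refl
  red-sym (Le i) (L l)  = refl
  red-sym (Le i) (Le j) = refl
  red-sym (Le i) (Ri j) = refl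
  red-sym (Ri j) X      = refl
  red-sym (Ri j) (K a)  = refl
  red-sym (Ri j) (L l)  = refl
  red-sym (Ri j) (Le i) = refl
  red-sym (Ri j) (Ri i) = refl

  inRim : V → Bool
  inRim (Le _) = true
  inRim (Ri _) = true
  inRim _      = false

  hub : Bool → V
  hub true  = X
  hub false = r₀

  K≢L : ∀ (a : Fin (suc κ)) (l : Fin ℓ) → toℕ a ≢ suc κ + toℕ l
  K≢L a l e = <⇒≢ (<-≤-trans (toℕ<n a) (m≤m+n (suc κ) (toℕ l))) e

  same : ∀ i j n → (i ≡ᵇ n) ≡ true → (j ≡ᵇ n) ≡ true → i ≡ j
  same i j n e f = trans (≡ᵇ⇒≡′ i n e) (sym (≡ᵇ⇒≡′ j n f))

  -- Requiring `p` and `q` to lie on the side of `w` filters out the hub, since `X` is not in the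
  -- rim and `r₀` is not in the core. What remains of the red edges at `w` is a matching.
  mate-unique : ∀ w p q → inRim p ≡ inRim w → inRim q ≡ inRim w →
                redV w p ≡ true → redV w q ≡ true → p ≡ q
  mate-unique (K a) (K b) (K c) _ _ e f = cong K (toℕ-injective
    (same (toℕ b) (toℕ c) (partner (toℕ a)) e f))
  mate-unique (K a) (K b) (L n) _ _ e f = contradiction
    (same (toℕ b) (suc κ + toℕ n) (partner (toℕ a)) e f) (K≢L b n)
  mate-unique (K a) (L m) (K c) _ _ e f = contradiction
    (sym (same (suc κ + toℕ m) (toℕ c) (partner (toℕ a)) e f)) (K≢L c m)
  mate-unique (K a) (L m) (L n) _ _ e f = cong L (toℕ-injective (+-cancelˡ-≡ (suc κ) _ _
    (same (suc κ + toℕ m) (suc κ + toℕ n) (partner (toℕ a)) e f)))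
  mate-unique (L l) (K b) (K c) _ _ e f = cong K (toℕ-injective
    (same (toℕ b) (toℕ c) (partner (suc κ + toℕ l)) (trans (≡ᵇ-partner-sym (toℕ b) (suc κ + toℕ l)) e) (trans (≡ᵇ-partner-sym (toℕ c) (suc κ + toℕ l)) f)))
  mate-unique (L l) (K b) (L n) _ _ e f = contradiction
    (same (toℕ b) (suc κ + toℕ n) (partner (suc κ + toℕ l)) (trans (≡ᵇ-partner-sym (toℕ b) (suc κ + toℕ l)) e) f) (K≢L b n)
  mate-unique (L l) (L m) (K c) _ _ e f = contradiction
    (sym (same (suc κ + toℕ m) (toℕ c) (partner (suc κ + toℕ l)) e (trans (≡ᵇ-partner-sym (toℕ c) (suc κ + toℕ l)) f))) (K≢L c m)
  mate-unique (L l) (L m) (L n) _ _ e f = cong L (toℕ-injective (+-cancelˡ-≡ (suc κ) _ _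
    (same (suc κ + toℕ m) (suc κ + toℕ n) (partner (suc κ + toℕ l)) e f)))
  mate-unique (Le i) (Ri j) (Ri h) _ _ e f = cong Ri (toℕ-injective (+-cancelˡ-≡ (toℕ i) _ _
    (trans (≡ᵇ⇒≡′ _ _ e) (sym (≡ᵇ⇒≡′ _ _ f)))))
  mate-unique (Ri j) (Le i) (Le h) _ _ e f = cong Le (toℕ-injective (+-cancelʳ-≡ (toℕ j) _ _
    (trans (≡ᵇ⇒≡′ _ _ e) (sym (≡ᵇ⇒≡′ _ _ f)))))
  mate-unique X      _ X _ _  _ ()
  mate-unique (K _)  _ X _ _  _ ()
  mate-unique (L _)  _ X _ _  _ ()
  mate-unique (Le _) _ X _ ()
  mate-unique (Ri _) _ X _ ()

  X-red⇒rim : ∀ w → redV X w ≡ true → inRim w ≡ true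
  X-red⇒rim (Le _) _ = refl
  X-red⇒rim (Ri _) _ = refl

  -- The red graph consists of two windmills, centred at `X` and at `r₀`: a matched set, all of it
  -- joined to the centre. They share only `r₀`, so every block is a triangle or a single edge, and
  -- there is no C₄.
  hub-or-mate : ∀ w p → w ≢ X → w ≢ r₀ → redV w p ≡ true → p ≡ hub (inRim w) ⊎ inRim p ≡ inRim w
  hub-or-mate X          p         w≢X _    _ = contradiction refl w≢X
  hub-or-mate (K a)      (K b)     _   _    _ = inj₂ refl
  hub-or-mate (K a)      (L l)     _   _    _ = inj₂ refl
  hub-or-mate (K a)      (Le zero) _   _    _ = inj₁ refl
  hub-or-mate (L l)      (K b)     _   _    _ = inj₂ refl
  hub-or-mate (L l)      (L m)     _   _    _ = inj₂ refl
  hub-or-mate (L l)      (Le zero) _   _    _ = inj₁ refl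
  hub-or-mate (Le zero)  _         _   w≢r₀ _ = contradiction refl w≢r₀
  hub-or-mate (Le (suc i)) X       _   _    _ = inj₁ refl
  hub-or-mate (Le (suc i)) (Ri j)  _   _    _ = inj₂ refl
  hub-or-mate (Ri j)     X         _   _    _ = inj₁ refl
  hub-or-mate (Ri j)     (Le i)    _   _    _ = inj₂ refl

  flip-red : ∀ {v w} → redV v w ≡ true → redV w v ≡ true
  flip-red {v} {w} e = trans (red-sym w v) e

  -- A common red neighbour of the hub and of the mate `q` lies on the side of `q`, so it is the
  -- mate of `q`, which is `w`. In the core, `q` is also red to `r₀`, but `r₀` is not a neighbour of
  -- itself.
  hub-mate-no-C₄ : ∀ w q y → w ≢ X → w ≢ r₀ → inRim q ≡ inRim w →
    redV w q ≡ true → redV (hub (inRim w)) y ≡ true → redV q y ≡ true → y ≡ w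
  hub-mate-no-C₄ w q y w≢X w≢r₀ same wq hy qy with inRim w in e
  ... | true  = mate-unique q y w (trans (X-red⇒rim y hy) (sym same)) (trans e (sym same)) qy (flip-red {w} wq)
  ... | false with hub-or-mate q y q≢X q≢r₀ qy
    where
    q≢X : q ≢ X
    q≢X refl = true≢false (X-red⇒rim w (flip-red {w} wq)) e
    q≢r₀ : q ≢ r₀
    q≢r₀ refl = true≢false refl same
  ...   | inj₂ same′ = mate-unique q y w same′ (trans e (sym same)) qy (flip-red {w} wq)
  ...   | inj₁ y≡hub rewrite same with refl ← y≡hub with () ← hy

  -- At most one of `p` and `q` is a mate of `w` and at most one is its hub, so there is one of
  -- each.
  no-C₄-at : ∀ w p q y → w ≢ X → w ≢ r₀ → p ≢ q → redV w p ≡ true → redV w q ≡ true →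
             redV p y ≡ true → redV q y ≡ true → y ≡ w
  no-C₄-at w p q y w≢X w≢r₀ p≢q wp wq py qy with hub-or-mate w p w≢X w≢r₀ wp | hub-or-mate w q w≢X w≢r₀ wq
  ... | inj₁ refl  | inj₁ refl  = contradiction refl p≢q
  ... | inj₂ pmate | inj₂ qmate = contradiction (mate-unique w p q pmate qmate wp wq) p≢q
  ... | inj₁ refl  | inj₂ qmate = hub-mate-no-C₄ w q y w≢X w≢r₀ qmate wq py qy
  ... | inj₂ pmate | inj₁ refl  = hub-mate-no-C₄ w p y w≢X w≢r₀ pmate wp qy py

  hub? : ∀ w → w ≡ X ⊎ w ≡ r₀ ⊎ (w ≢ X × w ≢ r₀)
  hub? X            = inj₁ refl
  hub? (Le zero)    = inj₂ (inj₁ refl)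
  hub? (K a)        = inj₂ (inj₂ ((λ ()) , λ ()))
  hub? (L l)        = inj₂ (inj₂ ((λ ()) , λ ()))
  hub? (Le (suc i)) = inj₂ (inj₂ ((λ ()) , λ ()))
  hub? (Ri j)       = inj₂ (inj₂ ((λ ()) , λ ()))

  -- Three distinct vertices of the cycle cannot all be among `X` and `r₀`, so `no-C₄-at` applies to
  -- one of `a`, `b`, `c`.
  red-no-C₄ : ∀ a b c d → a ≢ b → a ≢ c → b ≢ c → b ≢ d →
    redV a b ≡ true → redV b c ≡ true → redV c d ≡ true → redV d a ≡ true → ⊥
  red-no-C₄ a b c d a≢b a≢c b≢c b≢d ab bc cd da with hub? a | hub? b | hub? c
  ... | inj₂ (inj₂ (≢X , ≢r₀)) | _ | _ =
    a≢c (sym (no-C₄-at a b d c ≢X ≢r₀ b≢d ab (flip-red {d} da) bc (flip-red {c} cd)))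
  ... | _ | inj₂ (inj₂ (≢X , ≢r₀)) | _ =
    b≢d (sym (no-C₄-at b a c d ≢X ≢r₀ a≢c (flip-red {a} ab) bc (flip-red {d} da) cd))
  ... | _ | _ | inj₂ (inj₂ (≢X , ≢r₀)) =
    a≢c (no-C₄-at c b d a ≢X ≢r₀ b≢d (flip-red {b} bc) cd (flip-red {a} ab) da)
  ... | inj₁ refl        | inj₁ refl        | _                = a≢b refl
  ... | inj₂ (inj₁ refl) | inj₂ (inj₁ refl) | _                = a≢b refl
  ... | inj₁ refl        | inj₂ (inj₁ refl) | inj₁ refl        = a≢c refl
  ... | inj₁ refl        | inj₂ (inj₁ refl) | inj₂ (inj₁ refl) = b≢c refl
  ... | inj₂ (inj₁ refl) | inj₁ refl        | inj₁ refl        = b≢c refl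
  ... | inj₂ (inj₁ refl) | inj₁ refl        | inj₂ (inj₁ refl) = a≢c refl

  blueV : V → V → Bool
  blueV v w = adjV v w ∧ not (redV v w)

  -- The sum of `i` and its opposite is `μ`, the first number of the window.
  rim-mate : ∀ i → rim i (opposite i) ≡ true × (toℕ i + toℕ (opposite i) ≡ᵇ μ) ≡ true
  rim-mate i = cong (_∨ window μ (suc κ) (toℕ i + (suc μ + toℕ (opposite i)))) window-i , trans (cong (_≡ᵇ μ) i+opp) (≡ᵇ-refl μ)
    where
    i+opp : toℕ i + toℕ (opposite i) ≡ μ
    i+opp = trans (cong (toℕ i +_) (opposite-prop i)) (m+[n∸m]≡n (toℕ≤pred[n] i))
    window-i : window μ (suc κ) (toℕ i + toℕ (opposite i)) ≡ true
    window-i rewrite i+opp | <ᵇ-false (≤-refl {μ}) = <ᵇ-true (m<m+n μ (s≤s z≤n))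

  sum-strict : ∀ {n} (p q : Fin n → Bool) c i → p i ≡ true → q i ≡ true →
    sum (λ j → [ p j ]) ≡ suc c → sum (λ j → [ p j ∧ not (q j) ]) ≤ c
  sum-strict {n} p q c i pi qi e = ≤-pred (subst (suc (sum (λ j → [ p j ∧ not (q j) ])) ≤_) e
    (Counting.count-strict (↔-id (Fin n)) {λ j → p j ∧ not (q j)} {p} (λ j → ∧-conicalˡ (p j) _) i
      (trans (cong (λ b → p i ∧ not b) qi) (∧-zeroʳ (p i))) pi))

  count-≥2 : ∀ p a b → p a ≡ true → p b ≡ true → a ≢ b → 2 ≤ count p
  count-≥2 p a b pa pb a≢b = subst (2 ≤_) (sym (count-remove p a pa)) (s≤s
    (subst (1 ≤_) (sym (count-remove (remove a p) b (∧-true pb (cong not (≢⇒== λ b≡a → a≢b (sym b≡a)))))) (s≤s z≤n)))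

  -- Of the `κ + 2` edges at `K a`, those to `r₀` and to its partner are red.
  blue≤-K : ∀ a → count (blueV (K a)) ≤ κ
  blue≤-K a = +-cancelˡ-≤ 2 _ _ (begin
    2 + count (blueV (K a))                       ≤⟨ +-monoˡ-≤ _ (go (matched a)) ⟩
    count redK + count (blueV (K a))              ≡⟨ count-partition (adjV (K a)) (redV (K a)) ⟨
    count (adjV (K a))                            ≡⟨ deg-K a ⟩
    2 + κ                                         ∎)
    where
    open ≤-Reasoning
    redK : V → Bool
    redK w = adjV (K a) w ∧ redV (K a) w
    go : _ → 2 ≤ count redK
    go (inj₁ (b , adj , e)) = count-≥2 redK r₀ (K b) refl
      (∧-true adj (trans (cong (_≡ᵇ partner (toℕ a)) e) (≡ᵇ-refl (partner (toℕ a))))) (λ ())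
    go (inj₂ (l , adj , e)) = count-≥2 redK r₀ (L l) refl
      (∧-true adj (trans (cong (_≡ᵇ partner (toℕ a)) e) (≡ᵇ-refl (partner (toℕ a))))) (λ ())

  isZero-blue : ∀ n i → sum {n} (λ _ → [ isZero i ∧ not (isZero i) ]) ≡ 0
  isZero-blue n i = sum-zero {n} λ _ → cong [_] (∧-inverseʳ (isZero i))

  -- Blue edges at `X` lead exactly to `near`. A rim vertex has `suc κ` edges to the opposite side,
  -- one of them red; all edges from `r₀` to the core are red and cancel.
  blue≤ : ∀ v → count (blueV v) ≤ κ
  blue≤ X = ≤-reflexive (trans (count-cong {blueV X} {near} pointwise) count-near)
    where
    pointwise : ∀ w → blueV X w ≡ near w
    pointwise X      = refl
    pointwise (K a)  = ∧-identityʳ (small a)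
    pointwise (L l)  = refl
    pointwise (Le i) = refl
    pointwise (Ri j) = refl
  blue≤ (K a) = blue≤-K a
  blue≤ (L l) = begin
    count (blueV (L l))                  ≡⟨ count-V (blueV (L l)) ⟩
    _                                    ≡⟨ cong (s +_) (trans (cong (t +_) (cong₂ _+_
                                              (sum-zero {suc μ} λ i → cong [_] (∧-inverseʳ (isZero i))) (zeros (suc μ)))) (+-identityʳ t)) ⟩
    s + t                                ≤⟨ blue-outer l ⟩
    κ                                    ∎
    where
    open ≤-Reasoning
    s = sum (λ a → [ outer a l ∧ not (suc κ + toℕ l ≡ᵇ partner (toℕ a)) ])
    t = sum (λ l′ → [ not ⌊ l ≟ l′ ⌋ ∧ not (suc κ + toℕ l′ ≡ᵇ partner (suc κ + toℕ l)) ])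
  blue≤ (Le i) = begin
    count (blueV (Le i))                 ≡⟨ count-V (blueV (Le i)) ⟩
    _                                    ≡⟨ cong₂ _+_ (isZero-blue (suc κ) i) (cong₂ _+_ (isZero-blue ℓ i) (cong (_+ t) (zeros (suc μ)))) ⟩
    t                                    ≤⟨ sum-strict (rim i) (λ j → toℕ i + toℕ j ≡ᵇ μ) κ (opposite i)
                                              (proj₁ (rim-mate i)) (proj₂ (rim-mate i)) (sum-rim i) ⟩
    κ                                    ∎
    where
    open ≤-Reasoning
    t = sum (λ j → [ rim i j ∧ not (toℕ i + toℕ j ≡ᵇ μ) ])
  blue≤ (Ri j) = begin
    count (blueV (Ri j))                 ≡⟨ count-V (blueV (Ri j)) ⟩
    _                                    ≡⟨ cong₂ _+_ (zeros (suc κ)) (cong₂ _+_ (zeros ℓ) (trans (cong (t +_) (zeros (suc μ))) (+-identityʳ t))) ⟩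
    t                                    ≤⟨ sum-strict (λ i → rim i j) (λ i → toℕ i + toℕ j ≡ᵇ μ) κ (opposite j)
                                              (trans (rim-sym (opposite j) j) (proj₁ (rim-mate j)))
                                              (trans (cong (_≡ᵇ μ) (+-comm (toℕ (opposite j)) (toℕ j))) (proj₂ (rim-mate j)))
                                              (sum-rimᵗ j) ⟩
    κ                                    ∎
    where
    open ≤-Reasoning
    t = sum (λ i → [ rim i j ∧ not (toℕ i + toℕ j ≡ᵇ μ) ])

  -- Passage to `Fin`, co-criticality and the number of edges

  from-injective : ∀ {v w} → from v ≡ from w → v ≡ w
  from-injective {v} {w} e = trans (sym (to∘from v)) (trans (cong to e) (to∘from w))

  to-injective : ∀ {i j} → to i ≡ to j → i ≡ j
  to-injective {i} {j} e = trans (sym (from∘to i)) (trans (cong from e) (from∘to j))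

  G : Graph (order κ ℓ μ)
  G = record
    { adj    = λ i j → adjV (to i) (to j)
    ; sym    = λ i j → adjV-sym (to i) (to j)
    ; irrefl = λ i → adjV-irrefl (to i)
    }

  colour : Bool → Colour
  colour true  = red
  colour false = blue

  colour-red : ∀ {b} → colour b ≡ red → b ≡ true
  colour-red {true} _ = refl

  colour-blue : ∀ {b} → colour b ≡ blue → b ≡ false
  colour-blue {false} _ = refl

  admits-critical : AdmitsCritical (suc κ) (adj G)
  admits-critical =
      record { col    = λ i j → colour (redV (to i) (to j))
             ; colSym = λ i j → cong colour (red-sym (to i) (to j)) }
    , (λ { (a , b , c , d , a≢b , a≢c , a≢d , b≢c , b≢d , c≢d , _ , _ , _ , _ , ab , bc , cd , da) →
           red-no-C₄ (to a) (to b) (to c) (to d) (a≢b ∘ to-injective) (a≢c ∘ to-injective)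
             (b≢c ∘ to-injective) (b≢d ∘ to-injective)
             (colour-red ab) (colour-red bc) (colour-red cd) (colour-red da) })
    , λ { (v , leaf , inj , adjacent , isBlue) → 1+n≰n (≤-trans
           (injection⇒count (suc κ) (blueV (to v)) (to ∘ leaf) (inj ∘ to-injective)
             (λ i → ∧-true (adjacent i) (cong not (colour-blue (isBlue i)))))
           (blue≤ (to v))) }

  isRed : Colour → Bool
  isRed red  = true
  isRed blue = false

  isRed⇒ : ∀ {c} → isRed c ≡ true → c ≡ red
  isRed⇒ {red} _ = refl

  ¬isRed⇒ : ∀ {c} → isRed c ≡ false → c ≡ blue
  ¬isRed⇒ {blue} _ = refl

  no-critical : ∀ u v → u ≢ v → adj G u v ≡ false → ¬ AdmitsCritical (suc κ) (addEdge (adj G) u v)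
  no-critical u v u≢v u≁v (c , ¬C₄ , ¬star) =
    Forcing.absurd (to u) (to v) (u≢v ∘ to-injective) u≁v A R
      (λ {a} {b} → adj⇒A {a} {b}) A-uv A-vu (λ {a} {b} → A⇒adj {a} {b}) (λ {a} {b} → ∧-conicalˡ (A a b) _)
      (λ {a} {b} e → ∧-true (trans (A-sym b a) (∧-conicalˡ (A a b) _ e))
                            (trans (cong isRed (colSym c (from b) (from a))) (∧-conicalʳ (A a b) _ e)))
      blue≤κ no-C₄
    where
    A′ : Fin (order κ ℓ μ) → Fin (order κ ℓ μ) → Bool
    A′ = addEdge (adj G) u v
    A R : V → V → Bool
    A a b = A′ (from a) (from b)
    -- The conjunct `A a b` matters because a colouring takes arbitrary values on non-edges.
    R a b = A a b ∧ isRed (col c (from a) (from b))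

    adj-from : ∀ a b → adj G (from a) (from b) ≡ adjV a b
    adj-from a b = cong₂ adjV (to∘from a) (to∘from b)

    adj⇒A : ∀ {a b} → adjV a b ≡ true → A a b ≡ true
    adj⇒A {a} {b} e = cong (_∨ ((⌊ from a ≟ u ⌋ ∧ ⌊ from b ≟ v ⌋) ∨ (⌊ from a ≟ v ⌋ ∧ ⌊ from b ≟ u ⌋))) (trans (adj-from a b) e)

    A-uv : A (to u) (to v) ≡ true
    A-uv rewrite from∘to u | from∘to v | isYes-refl u | isYes-refl v = ∨-zeroʳ _

    A-vu : A (to v) (to u) ≡ true
    A-vu rewrite from∘to u | from∘to v | isYes-refl u | isYes-refl v =
      trans (cong (adj G v u ∨_) (∨-zeroʳ _)) (∨-zeroʳ _)

    A-sym : ∀ a b → A a b ≡ A b a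
    A-sym a b = cong₂ _∨_ (Graph.sym G (from a) (from b))
      (trans (cong₂ _∨_ (∧-comm ⌊ from a ≟ u ⌋ _) (∧-comm ⌊ from a ≟ v ⌋ _))
             (∨-comm (⌊ from b ≟ v ⌋ ∧ ⌊ from a ≟ u ⌋) _))

    meets : ∀ {a x b y} → ⌊ from a ≟ x ⌋ ∧ ⌊ from b ≟ y ⌋ ≡ true → a ≡ to x × b ≡ to y
    meets {a} {x} {b} {y} e =
        trans (sym (to∘from a)) (cong to (isYes-true _ x (∧-conicalˡ ⌊ from a ≟ x ⌋ _ e)))
      , trans (sym (to∘from b)) (cong to (isYes-true _ y (∧-conicalʳ ⌊ from a ≟ x ⌋ _ e)))

    A⇒adj : ∀ {a b} → A a b ≡ true →
            adjV a b ≡ true ⊎ (a ≡ to u × b ≡ to v) ⊎ (a ≡ to v × b ≡ to u)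
    A⇒adj {a} {b} e with ∨-true (adj G (from a) (from b)) e
    ... | inj₁ old = inj₁ (trans (sym (adj-from a b)) old)
    ... | inj₂ new with ∨-true (⌊ from a ≟ u ⌋ ∧ ⌊ from b ≟ v ⌋) new
    ...   | inj₁ uv = inj₂ (inj₁ (meets uv))
    ...   | inj₂ vu = inj₂ (inj₂ (meets vu))

    blue≤κ : ∀ a → count (λ b → A a b ∧ not (R a b)) ≤ κ
    blue≤κ a = ≮⇒≥ λ κ< →
      let f , inj , isBlue = count⇒injection (suc κ) (λ b → A a b ∧ not (R a b)) κ<
      in ¬star (from a , from ∘ f , inj ∘ from-injective , (λ i → ∧-conicalˡ (A a (f i)) _ (isBlue i))
               , λ i → ¬isRed⇒ (not-red (∧-conicalˡ (A a (f i)) _ (isBlue i)) (∧-conicalʳ (A a (f i)) _ (isBlue i))))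
      where
      not-red : ∀ {x y} → x ≡ true → not (x ∧ y) ≡ true → y ≡ false
      not-red refl = not-false

    R-irrefl : ∀ {a} → R a a ≡ true → ⊥
    R-irrefl {a} e with A⇒adj {a} {a} (∧-conicalˡ (A a a) _ e)
    ... | inj₁ adj             = true≢false adj (adjV-irrefl a)
    ... | inj₂ (inj₁ (p , q)) = u≢v (to-injective (trans (sym p) q))
    ... | inj₂ (inj₂ (p , q)) = u≢v (to-injective (trans (sym q) p))

    -- `RedC4` asks for six inequalities. The four between consecutive vertices follow from the
    -- absence of red loops.
    no-C₄ : ∀ {a b c d} → a ≢ c → b ≢ d → R a b ≡ true → R b c ≡ true →
            R c d ≡ true → R d a ≡ true → ⊥
    no-C₄ {x} {y} {z} {w} x≢z y≢w xy yz zw wx = ¬C₄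
      ( from x , from y , from z , from w
      , (λ e → distinct xy (from-injective e)) , x≢z ∘ from-injective , (λ e → distinct wx (sym (from-injective e)))
      , (λ e → distinct yz (from-injective e)) , y≢w ∘ from-injective , (λ e → distinct zw (from-injective e))
      , ∧-conicalˡ (A x y) _ xy , ∧-conicalˡ (A y z) _ yz , ∧-conicalˡ (A z w) _ zw , ∧-conicalˡ (A w x) _ wx
      , isRed⇒ (∧-conicalʳ (A x y) _ xy) , isRed⇒ (∧-conicalʳ (A y z) _ yz)
      , isRed⇒ (∧-conicalʳ (A z w) _ zw) , isRed⇒ (∧-conicalʳ (A w x) _ wx) )
      where
      distinct : ∀ {a b} → R a b ≡ true → a ≢ b
      distinct e refl = R-irrefl e

  co-critical : CoCritical (suc κ) G
  -- The last vertex of `K` is the only one in that block not joined to `X`.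
  co-critical = (from X , from (K (fromℕ κ)) , (λ ()) , non-edge) , admits-critical , no-critical
    where
    non-edge : adjV (to (from X)) (to (from (K (fromℕ κ)))) ≡ false
    non-edge = trans (cong (adjV X) (to∘from (K (fromℕ κ))))
                     (trans (cong (_<ᵇ κ) (toℕ-fromℕ κ)) (<ᵇ-false (≤-refl {κ})))

  edge-count : 2 * edgeCount G ≡ edges κ ℓ μ (sum (λ l → sum (λ a → [ outer a l ])))
  edge-count = begin
    2 * edgeCount G
      ≡⟨ handshake G ⟩
    sum (λ i → count (adjV (to i)))
      ≡⟨ sum-V (λ v → count (adjV v)) ⟩
    count (adjV X) + (sum (λ a → count (adjV (K a))) + (sum (λ l → count (adjV (L l))) +
      (sum (λ i → count (adjV (Le i))) + sum (λ j → count (adjV (Ri j))))))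
      ≡⟨ cong₂ _+_ deg-X (cong₂ _+_
           (trans (sum-cong-≗ deg-K) (sum-const (suc κ) (suc (suc κ))))
           (cong₂ _+_
             (trans (sum-cong-≗ deg-L) (trans (∑-distrib-+ {ℓ} (λ l → sum (λ a → [ outer a l ])) (λ _ → ℓ))
               (cong (sum (λ l → sum (λ a → [ outer a l ])) +_) (sum-const ℓ ℓ))))
             (cong₂ _+_ left (trans (sum-cong-≗ deg-Ri) (sum-const (suc μ) (suc (suc κ))))))) ⟩
    _ ∎
    where
    open ≡-Reasoning
    c : ℕ
    c = suc κ + ℓ
    at-zero : sum (λ i → c * [ isZero i ]) ≡ c
    at-zero = trans (cong₂ _+_ (*-identityʳ c) (sum-zero {μ} λ _ → *-zeroʳ c)) (+-identityʳ c)
    left : sum (λ i → count (adjV (Le i))) ≡ suc μ + (c + suc μ * suc κ)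
    left = begin
      sum (λ i → count (adjV (Le i)))
        ≡⟨ sum-cong-≗ deg-Le ⟩
      sum (λ i → 1 + (c * [ isZero i ] + suc κ))
        ≡⟨ ∑-distrib-+ {suc μ} (λ _ → 1) (λ i → c * [ isZero i ] + suc κ) ⟩
      sum {suc μ} (λ _ → 1) + sum (λ i → c * [ isZero i ] + suc κ)
        ≡⟨ cong₂ _+_ (ones (suc μ)) (∑-distrib-+ {suc μ} (λ i → c * [ isZero i ]) (λ _ → suc κ)) ⟩
      suc μ + (sum (λ i → c * [ isZero i ]) + sum {suc μ} (λ _ → suc κ))
        ≡⟨ cong (suc μ +_) (cong₂ _+_ at-zero (sum-const (suc μ) (suc κ))) ⟩
      suc μ + (c + suc μ * suc κ) ∎

-- Parity, partners and auxiliary sums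

double : ℕ → ℕ
double zero    = zero
double (suc h) = suc (suc (double h))

-- The remainder is stored because `double h % 2` does not reduce for a variable `h`; rewriting with
-- it evaluates the remainders in the theorem.
data Parity : ℕ → Set where
  even : ∀ h → double h % 2 ≡ 0 → Parity (double h)
  odd  : ∀ h → suc (double h) % 2 ≡ 1 → Parity (suc (double h))

parity : ∀ n → Parity n
parity zero          = even 0 refl
parity (suc zero)    = odd 0 refl
parity (suc (suc n)) with parity n
... | even h e = even (suc h) e
... | odd h e  = odd (suc h) e

double≡ : ∀ h → double h ≡ h + h
double≡ zero    = refl
double≡ (suc h) = cong suc (trans (cong suc (double≡ h)) (sym (+-suc h h)))

double-cancel-≤ : ∀ a b → double a ≤ suc (double b) → a ≤ b
double-cancel-≤ zero    b       _                = z≤n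
double-cancel-≤ (suc a) zero    (s≤s ())
double-cancel-≤ (suc a) (suc b) (s≤s (s≤s h))    = s≤s (double-cancel-≤ a b h)

partner-< : ∀ h a → a < double h → partner a < double h
partner-< (suc h) zero          _             = s≤s (s≤s z≤n)
partner-< (suc h) (suc zero)    _             = s≤s z≤n
partner-< (suc h) (suc (suc a)) (s≤s (s≤s l)) = s≤s (s≤s (partner-< h a l))

partner-double : ∀ h → partner (double h) ≡ suc (double h)
partner-double zero    = refl
partner-double (suc h) = cong (λ i → suc (suc i)) (partner-double h)

partner≢ : ∀ a → partner a ≢ a
partner≢ (suc (suc a)) e = partner≢ a (cong (λ i → i ∸ 2) e)

≢⇒isNo : ∀ {n} {i j : Fin n} → toℕ i ≢ toℕ j → not ⌊ i ≟ j ⌋ ≡ true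
≢⇒isNo {i = i} {j} i≢j with i ≟ j
... | yes refl = contradiction refl i≢j
... | no _     = refl

sum-others : ∀ {n} (a : Fin (suc n)) → sum (λ b → [ not ⌊ a ≟ b ⌋ ]) ≡ n
sum-others {n} a = +-cancelˡ-≡ 1 _ _ (trans
  (cong (_+ sum (λ b → [ not ⌊ a ≟ b ⌋ ])) (sym (trans (sum-cong-≗ λ b → cong [_] (isYes-sym a b)) (sum-≟ a))))
  (sum-not (λ b → ⌊ a ≟ b ⌋)))

sum-∧≤ : ∀ {n} (p q : Fin n → Bool) → sum (λ i → [ p i ∧ q i ]) ≤ sum (λ i → [ p i ])
sum-∧≤ p q = sum-mono λ i → []-mono (∧-conicalˡ (p i) (q i))

sum≤n : ∀ {n} (p : Fin n → Bool) → sum (λ i → [ p i ]) ≤ n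
sum≤n {n} p = subst (_≤_ (sum (λ i → [ p i ]))) (sum-not p) (m≤m+n _ _)

sum-last : ∀ κ → sum {suc κ} (λ a → [ not (toℕ a <ᵇ κ) ]) ≡ 1
sum-last κ = +-cancelˡ-≡ κ _ _ (trans
  (cong (_+ sum {suc κ} (λ a → [ not (toℕ a <ᵇ κ) ])) (sym (sum-below {suc κ} κ (n≤1+n κ))))
  (trans (sum-not {suc κ} (λ a → toℕ a <ᵇ κ)) (+-comm 1 κ)))

last-unique : ∀ {κ} (a : Fin (suc κ)) → (toℕ a <ᵇ κ) ≡ false → toℕ a ≡ κ
last-unique a e = ≤-antisym (toℕ≤pred[n] a) (≮⇒≥ λ a<κ → true≢false (<ᵇ-true a<κ) e)

-- The core for odd k

module OddCore (h ℓ : ℕ) (ℓ≤ : ℓ ≤ double h) where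
  κ : ℕ
  κ = double h

  inner : Fin (suc κ) → Fin (suc κ) → Bool
  inner a b = not ⌊ a ≟ b ⌋

  -- The last vertex of `K` gets an edge to `L zero` in exchange for the missing one to `X`. As `κ`
  -- is even, its partner number is `suc κ`, the number of `L zero`, so this edge is red.
  outer : Fin (suc κ) → Fin (suc ℓ) → Bool
  outer a zero    = not (toℕ a <ᵇ κ)
  outer a (suc _) = false

  degree : ∀ a → [ toℕ a <ᵇ κ ] + (sum (λ b → [ inner a b ]) + sum (λ l → [ outer a l ])) ≡ suc κ
  degree a rewrite sum-others a | sum-zero {ℓ} {λ _ → 0} (λ _ → refl) with toℕ a <ᵇ κ
  ... | true  = cong suc (+-identityʳ κ)
  ... | false = +-comm κ 1

  partner-last : ∀ (a : Fin (suc κ)) → (toℕ a <ᵇ κ) ≡ false → suc κ + 0 ≡ partner (toℕ a)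
  partner-last a e = trans (+-identityʳ (suc κ))
    (trans (sym (partner-double h)) (cong partner (sym (last-unique a e))))

  matched : ∀ a → (∃ λ b → inner a b ≡ true × toℕ b ≡ partner (toℕ a)) ⊎
                  (∃ λ l → outer a l ≡ true × suc κ + toℕ l ≡ partner (toℕ a))
  matched a with bool-cases (toℕ a <ᵇ κ)
  ... | inj₁ a<κ = inj₁ (b , ≢⇒isNo (λ a≡b → partner≢ (toℕ a) (trans (sym b≡) (sym a≡b))) , b≡)
    where
    partner<k : partner (toℕ a) < suc κ
    partner<k = m≤n⇒m≤1+n (partner-< h (toℕ a) (<ᵇ⇒<′ (toℕ a) κ a<κ))
    b = fromℕ< partner<k
    b≡ : toℕ b ≡ partner (toℕ a)
    b≡ = toℕ-fromℕ< partner<k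
  ... | inj₂ a≮κ = inj₂ (zero , cong not a≮κ , partner-last a a≮κ)

  outer-red : ∀ l → sum (λ a → [ outer a l ∧ not (suc κ + toℕ l ≡ᵇ partner (toℕ a)) ]) ≡ 0
  outer-red zero = sum-zero λ a → cong [_] (pointwise a)
    where
    pointwise : ∀ a → not (toℕ a <ᵇ κ) ∧ not (suc κ + 0 ≡ᵇ partner (toℕ a)) ≡ false
    pointwise a with toℕ a <ᵇ κ in e
    ... | true  = refl
    ... | false = cong not (trans (cong (suc κ + 0 ≡ᵇ_) (sym (partner-last a e))) (≡ᵇ-refl (suc κ + 0)))
  outer-red (suc l) = sum-zero {suc κ} λ _ → refl

  -- The single edge between `K` and `L` is red, so blue edges at `L l` lead to at most the `ℓ`
  -- other vertices of `L`.
  blue-outer : ∀ l →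
    sum (λ a → [ outer a l ∧ not (suc κ + toℕ l ≡ᵇ partner (toℕ a)) ]) +
    sum (λ l′ → [ not ⌊ l ≟ l′ ⌋ ∧ not (suc κ + toℕ l′ ≡ᵇ partner (suc κ + toℕ l)) ]) ≤ κ
  blue-outer l = +-mono-≤ (≤-reflexive (outer-red l))
    (≤-trans (sum-∧≤ (λ l′ → not ⌊ l ≟ l′ ⌋) (λ l′ → not (suc κ + toℕ l′ ≡ᵇ partner (suc κ + toℕ l))))
      (≤-trans (≤-reflexive (sum-others l)) ℓ≤))

  core : Core κ (suc ℓ)
  core = record
    { inner        = inner
    ; outer        = outer
    ; inner-sym    = λ a b → cong not (isYes-sym a b)
    ; inner-irrefl = λ a → cong not (isYes-refl a)
    ; degree       = degree
    ; matched      = matched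
    ; blue-outer   = blue-outer
    }

  sum-outer : sum (λ l → sum (λ a → [ outer a l ])) ≡ 1
  sum-outer = cong₂ _+_ (sum-last κ) (sum-zero {ℓ} λ _ → sum-zero {suc κ} λ _ → refl)

-- The core for even k

mate : ℕ → ℕ
mate zero    = zero
mate (suc a) = suc (partner a)

≡ᵇ-mate-sym : ∀ i j → (i ≡ᵇ mate j) ≡ (j ≡ᵇ mate i)
≡ᵇ-mate-sym zero    zero    = refl
≡ᵇ-mate-sym zero    (suc j) = refl
≡ᵇ-mate-sym (suc i) zero    = refl
≡ᵇ-mate-sym (suc i) (suc j) = ≡ᵇ-partner-sym i j

-- Guarantees that the matching deleted from the clique avoids the red matching.
partner≢mate : ∀ a → partner a ≢ mate a
partner≢mate (suc (suc (suc a))) e = partner≢mate (suc a) (cong (λ i → i ∸ 2) e)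

module EvenCore (h ℓ : ℕ) (ℓ≤1 : ℓ ≤ 1) where
  κ : ℕ
  κ = suc (double (suc h))

  -- `mate` exchanges 2i + 1 and 2i + 2, so the deleted pairs are {1,2}, {3,4}, up to {κ-2,κ-1}. The
  -- vertices 0 and `κ` lose nothing: `mate` fixes 0, and sends the odd number `κ` to `suc κ`,
  -- outside `K`.
  inner : Fin (suc κ) → Fin (suc κ) → Bool
  inner a b = not ⌊ a ≟ b ⌋ ∧ not (toℕ b ≡ᵇ mate (toℕ a))

  -- Equalizes the degrees: the vertices 1 to `κ - 1` replace their lost mate by `L zero`, and
  -- vertex `κ` replaces `X` by `L (suc zero)`. Vertex 0 misses nothing.
  outer : Fin (suc κ) → Fin (suc (suc ℓ)) → Bool
  outer zero    _             = false
  outer (suc a) zero          = toℕ a <ᵇ double (suc h)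
  outer (suc a) (suc zero)    = not (toℕ a <ᵇ double (suc h))
  outer (suc a) (suc (suc _)) = false

  open Counting (↔-id (Fin (suc κ))) using (count-partition; count-unique; count-none)

  is-mate : Fin (suc κ) → Fin (suc κ) → Bool
  is-mate a b = not ⌊ a ≟ b ⌋ ∧ (toℕ b ≡ᵇ mate (toℕ a))

  sum-inner : ∀ a → κ ≡ sum (λ b → [ is-mate a b ]) + sum (λ b → [ inner a b ])
  sum-inner a = trans (sym (sum-others a)) (count-partition (λ b → not ⌊ a ≟ b ⌋) (λ b → toℕ b ≡ᵇ mate (toℕ a)))

  unmated : ∀ a → (∀ b → is-mate a b ≡ false) → sum (λ b → [ inner a b ]) ≡ κ
  unmated a none = trans (cong (_+ sum (λ b → [ inner a b ])) (sym (count-none {is-mate a} none))) (sym (sum-inner a))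

  mated : ∀ a b → is-mate a b ≡ true → suc (sum (λ b → [ inner a b ])) ≡ κ
  mated a b e = trans (cong (_+ sum (λ b → [ inner a b ])) (sym (count-unique {is-mate a} b e unique))) (sym (sum-inner a))
    where
    unique : ∀ c → is-mate a c ≡ true → c ≡ b
    unique c f = toℕ-injective (trans (≡ᵇ⇒≡′ (toℕ c) _ (∧-conicalʳ (not ⌊ a ≟ c ⌋) _ f))
                                 (sym (≡ᵇ⇒≡′ (toℕ b) _ (∧-conicalʳ (not ⌊ a ≟ b ⌋) _ e))))

  degree : ∀ a → [ toℕ a <ᵇ κ ] + (sum (λ b → [ inner a b ]) + sum (λ l → [ outer a l ])) ≡ suc κ
  degree zero = cong suc (trans (cong₂ _+_ (unmated zero none) (sum-zero {suc (suc ℓ)} λ _ → refl)) (+-identityʳ κ))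
    where
    none : ∀ b → is-mate zero b ≡ false
    none zero    = refl
    none (suc b) = refl
  degree (suc a) with bool-cases (toℕ a <ᵇ double (suc h))
  ... | inj₁ a< rewrite a< | sum-zero {ℓ} {λ _ → 0} (λ _ → refl) =
    cong suc (trans (+-comm _ 1) (mated (suc a) b (∧-true (≢⇒isNo a≢b) b≡ᵇ)))
    where
    mate<k : mate (suc (toℕ a)) < suc κ
    mate<k = s≤s (m≤n⇒m≤1+n (partner-< (suc h) (toℕ a) (<ᵇ⇒<′ (toℕ a) (double (suc h)) a<)))
    b : Fin (suc κ)
    b = fromℕ< mate<k
    b≡ : toℕ b ≡ suc (partner (toℕ a))
    b≡ = toℕ-fromℕ< mate<k
    b≡ᵇ : (toℕ b ≡ᵇ suc (partner (toℕ a))) ≡ true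
    b≡ᵇ = trans (cong (_≡ᵇ suc (partner (toℕ a))) b≡) (≡ᵇ-refl (partner (toℕ a)))
    a≢b : suc (toℕ a) ≢ toℕ b
    a≢b a≡b = partner≢ (toℕ a) (cong (_∸ 1) (trans (sym b≡) (sym a≡b)))
  ... | inj₂ a≮ rewrite a≮ | sum-zero {ℓ} {λ _ → 0} (λ _ → refl) =
    trans (cong (_+ 1) (unmated (suc a) none)) (+-comm κ 1)
    where
    mate≡ : mate (suc (toℕ a)) ≡ suc κ
    mate≡ = cong suc (trans (cong partner (last-unique a a≮)) (partner-double (suc h)))
    none : ∀ b → is-mate (suc a) b ≡ false
    none b = ¬-not λ e → <⇒≢ (toℕ<n b)
      (trans (≡ᵇ⇒≡′ (toℕ b) _ (∧-conicalʳ (not ⌊ suc a ≟ b ⌋) _ e)) mate≡)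

  -- Here `suc κ` is even, so partners of numbers in `K` stay in `K`.
  matched : ∀ a → (∃ λ b → inner a b ≡ true × toℕ b ≡ partner (toℕ a)) ⊎
                  (∃ λ l → outer a l ≡ true × suc κ + toℕ l ≡ partner (toℕ a))
  matched a = inj₁ (b , ∧-true (≢⇒isNo λ a≡b → partner≢ (toℕ a) (trans (sym b≡) (sym a≡b))) not-mate , b≡)
    where
    partner<k : partner (toℕ a) < suc κ
    partner<k = partner-< (suc (suc h)) (toℕ a) (toℕ<n a)
    b : Fin (suc κ)
    b = fromℕ< partner<k
    b≡ : toℕ b ≡ partner (toℕ a)
    b≡ = toℕ-fromℕ< partner<k
    not-mate : not (toℕ b ≡ᵇ mate (toℕ a)) ≡ true
    not-mate = cong not (¬-not λ e → partner≢mate (toℕ a) (trans (sym b≡) (≡ᵇ⇒≡′ (toℕ b) _ e)))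

  sum-middle : sum (λ a → [ outer a zero ]) ≡ double (suc h)
  sum-middle = sum-below {κ} (double (suc h)) (n≤1+n (double (suc h)))

  sum-end : sum (λ a → [ outer a (suc zero) ]) ≡ 1
  sum-end = sum-last (double (suc h))

  sum-none : ∀ l → sum (λ a → [ outer a (suc (suc l)) ]) ≡ 0
  sum-none l = sum-zero none
    where
    none : ∀ a → [ outer a (suc (suc l)) ] ≡ 0
    none zero    = refl
    none (suc a) = refl

  -- The bound is delicate only at `L zero`, which has `κ - 1` neighbours in `K`. The first two
  -- vertices of `L` are partners because `suc κ` is even, so their edge is red and `ℓ ≤ 1` leaves
  -- at most one blue edge from `L zero` inside `L`. Elsewhere the total is at most 3.
  blue-outer : ∀ l →
    sum (λ a → [ outer a l ∧ not (suc κ + toℕ l ≡ᵇ partner (toℕ a)) ]) +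
    sum (λ l′ → [ not ⌊ l ≟ l′ ⌋ ∧ not (suc κ + toℕ l′ ≡ᵇ partner (suc κ + toℕ l)) ]) ≤ κ
  blue-outer l = ≤-trans (+-monoˡ-≤ (blue-L l) (sum-∧≤ (λ a → outer a l) (λ a → not (suc κ + toℕ l ≡ᵇ partner (toℕ a))))) (bound l)
    where
    blue-L : Fin (suc (suc ℓ)) → ℕ
    blue-L l = sum (λ l′ → [ not ⌊ l ≟ l′ ⌋ ∧ not (suc κ + toℕ l′ ≡ᵇ partner (suc κ + toℕ l)) ])
    blue-L≤ : ∀ l → blue-L l ≤ 2
    blue-L≤ l = ≤-trans (sum-∧≤ (λ l′ → not ⌊ l ≟ l′ ⌋) (λ l′ → not (suc κ + toℕ l′ ≡ᵇ partner (suc κ + toℕ l))))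
      (≤-trans (≤-reflexive (sum-others l)) (s≤s ℓ≤1))
    first-matched : not (suc κ + 1 ≡ᵇ partner (suc κ + 0)) ≡ false
    first-matched = cong not (trans (cong (_≡ᵇ partner (suc κ + 0)) (trans (+-comm (suc κ) 1)
      (sym (trans (cong partner (+-identityʳ (suc κ))) (partner-double (suc (suc h))))))) (≡ᵇ-refl (partner (suc κ + 0))))
    bound : ∀ l → sum (λ a → [ outer a l ]) + blue-L l ≤ κ
    bound zero = begin
      sum (λ a → [ outer a zero ]) + blue-L zero  ≤⟨ +-mono-≤ (≤-reflexive sum-middle) blue-L₀ ⟩
      double (suc h) + 1                          ≡⟨ +-comm (double (suc h)) 1 ⟩
      κ                                           ∎
      where
      open ≤-Reasoning
      blue-L₀ : blue-L zero ≤ 1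
      blue-L₀ = ≤-trans (+-mono-≤ (≤-reflexive (cong [_] first-matched))
        (sum≤n {ℓ} (λ l′ → not (suc κ + suc (suc (toℕ l′)) ≡ᵇ partner (suc κ + 0))))) ℓ≤1
    bound (suc zero)    = ≤-trans (+-mono-≤ (≤-reflexive sum-end) (blue-L≤ (suc zero))) (s≤s (s≤s (s≤s z≤n)))
    bound (suc (suc l)) = ≤-trans (+-mono-≤ (≤-reflexive (sum-none l)) (blue-L≤ (suc (suc l)))) (s≤s (s≤s z≤n))

  core : Core κ (suc (suc ℓ))
  core = record
    { inner        = inner
    ; outer        = outer
    ; inner-sym    = λ a b → cong₂ (λ p q → not p ∧ not q) (isYes-sym a b) (≡ᵇ-mate-sym (toℕ b) (toℕ a))
    ; inner-irrefl = λ a → cong (λ p → not p ∧ not (toℕ a ≡ᵇ mate (toℕ a))) (isYes-refl a)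
    ; degree       = degree
    ; matched      = matched
    ; blue-outer   = blue-outer
    }

  sum-outer : sum (λ l → sum (λ a → [ outer a l ])) ≡ κ
  sum-outer = trans (cong₂ _+_ sum-middle (cong₂ _+_ sum-end (sum-zero sum-none))) (+-comm (double (suc h)) 1)

-- Choice of parameters and the four parity cases

build : ∀ κ ℓ μ (core : Core κ ℓ) E → sum (λ l → sum (λ a → [ Core.outer core a l ])) ≡ E →
        ∀ n → κ ≤ μ → order κ ℓ μ ≡ n →
        Σ (Graph n) λ G → CoCritical (suc κ) G × 2 * edgeCount G ≡ edges κ ℓ μ E
build κ ℓ μ core E refl _ κ≤μ refl = G , co-critical , edge-count
  where open Construction κ ℓ μ κ≤μ core

-- The names of the four identities give the parity of k = `suc κ`, then that of n. Each is `edges`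
-- at the chosen `ℓ` and `E`, namely `ℓ` equal to 2 or 3 and `E` equal to 1 or `κ`, compared with
-- the claimed value after moving subtractions across.
odd-even : ∀ κ μ →
  κ + (suc μ + suc μ) + (suc κ * suc (suc κ) + (1 + 2 * 2 +
    (suc μ + ((suc κ + 2) + suc μ * suc κ) + suc μ * suc (suc κ)))) + 2 * suc κ ≡
  (suc κ + 2) * suc (suc κ + (2 + (suc μ + suc μ))) + 0
odd-even = solve-∀

odd-odd : ∀ κ μ →
  κ + (suc μ + suc μ) + (suc κ * suc (suc κ) + (1 + 3 * 3 +
    (suc μ + ((suc κ + 3) + suc μ * suc κ) + suc μ * suc (suc κ)))) + 3 * suc κ ≡
  (suc κ + 2) * suc (suc κ + (3 + (suc μ + suc μ))) + 4
odd-odd = solve-∀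

even-even : ∀ κ μ →
  κ + (suc μ + suc μ) + (suc κ * suc (suc κ) + (κ + 3 * 3 +
    (suc μ + ((suc κ + 3) + suc μ * suc κ) + suc μ * suc (suc κ)))) + 2 * suc κ + 0 ≡
  (suc κ + 2) * suc (suc κ + (3 + (suc μ + suc μ))) + 2
even-even = solve-∀

even-odd : ∀ κ μ →
  κ + (suc μ + suc μ) + (suc κ * suc (suc κ) + (κ + 2 * 2 +
    (suc μ + ((suc κ + 2) + suc μ * suc κ) + suc μ * suc (suc κ)))) + 1 * suc κ + 4 ≡
  (suc κ + 2) * suc (suc κ + (2 + (suc μ + suc μ))) + 2
even-odd = solve-∀

-- Solves for `μ` in an order of the form `double (c + μ)`. The spare `suc` absorbs a rounding: for
-- even k the number 3k + 3 is odd, so an even order at least 3k + 3 is at least 3k + 4.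
fit : ∀ κ c N → double (κ + c) ≤ suc (double N) → Σ ℕ λ μ → κ ≤ μ × c + μ ≡ N
fit κ c N h = N ∸ c , m+n≤o⇒m≤o∸n κ κ+c≤N , m+[n∸m]≡n (≤-trans (m≤n+m c κ) κ+c≤N)
  where
  κ+c≤N : κ + c ≤ N
  κ+c≤N = double-cancel-≤ (κ + c) N h

-- The least order, attained at `μ ≡ κ`, with two vertices in `L`. It agrees with the bound of the
-- theorem for odd k and even n.
odd-size : ∀ h → double (double h + (3 + h)) ≡ 3 * suc (double h) + 3
odd-size h rewrite double≡ (double h + (3 + h)) | double≡ h = identity h
  where
  identity : ∀ h → (h + h + (3 + h)) + (h + h + (3 + h)) ≡ 3 * suc (h + h) + 3
  identity = solve-∀

even-size : ∀ h → double (suc (double h) + (4 + h)) ≡ suc (3 * double (suc h) + 3)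
even-size h rewrite double≡ (suc (double h) + (4 + h)) | double≡ h = identity h
  where
  identity : ∀ h → (suc (h + h) + (4 + h)) + (suc (h + h) + (4 + h)) ≡ suc (3 * suc (suc (h + h)) + 3)
  identity = solve-∀

odd-order : ∀ h μ → order (double h) 2 μ ≡ double (3 + h + μ)
odd-order h μ rewrite double≡ (h + μ) | double≡ h = identity h μ
  where
  identity : ∀ h μ → suc (suc (h + h) + (2 + (suc μ + suc μ))) ≡ 6 + ((h + μ) + (h + μ))
  identity = solve-∀

even-order : ∀ h μ → order (suc (double h)) 3 μ ≡ double (4 + h + μ)
even-order h μ rewrite double≡ (h + μ) | double≡ h = identity h μ
  where
  identity : ∀ h μ → suc (suc (suc (h + h)) + (3 + (suc μ + suc μ))) ≡ 8 + ((h + μ) + (h + μ))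
  identity = solve-∀

order-suc : ∀ κ ℓ μ → order κ (suc ℓ) μ ≡ suc (order κ ℓ μ)
order-suc κ ℓ μ = cong (λ i → suc (suc i)) (+-suc κ _)

theorem3p2 : (k n : ℕ) → 3 ≤ k →
    3 * k + 3 + 2 * (n % 2) * (k % 2) ≤ n + n % 2 →
    Σ (Graph n) λ G → CoCritical k G ×
    ((k % 2 ≡ 1 → 2 * edgeCount G + (2 + n % 2) * k ≡ (k + 2) * n + 4 * (n % 2)) ×
    (k % 2 ≡ 0 → 2 * edgeCount G + (2 ∸ n % 2) * k + 4 * (n % 2) ≡ (k + 2) * n + 2))
theorem3p2 k n 3≤k large with parity k | parity n
... | odd zero _ | _ with s≤s () ← 3≤k
... | even (suc zero) _ | _ with s≤s (s≤s ()) ← 3≤k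
theorem3p2 _ _ 3≤k large | odd (suc h) k-odd | even N n-even rewrite k-odd | n-even
  with μ , κ≤μ , N≡ ← fit (double (suc h)) (3 + suc h) N
         (subst (_≤ suc (double N)) (sym (odd-size (suc h))) (m≤n⇒m≤1+n (subst₂ _≤_ (+-identityʳ _) (+-identityʳ _) large)))
  with size ← trans (odd-order (suc h) μ) (cong double N≡)
  with G , cc , e ← build (double (suc h)) 2 μ (OddCore.core (suc h) 1 (s≤s z≤n)) 1
         (OddCore.sum-outer (suc h) 1 (s≤s z≤n)) _ κ≤μ size =
  G , cc , (λ _ → trans (cong (_+ 2 * suc κ) e) (trans (odd-even κ μ) (cong (λ i → (suc κ + 2) * i + 0) size))) , λ ()
  where κ = double (suc h)
-- A third vertex in `L` makes the order odd; the hypothesis reads n ≥ 3k + 4 here, which leaves 3k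
-- + 3 for the order without that vertex.
theorem3p2 _ _ 3≤k large | odd (suc h) k-odd | odd N n-odd rewrite k-odd | n-odd
  with μ , κ≤μ , N≡ ← fit (double (suc h)) (3 + suc h) N
         (subst (_≤ suc (double N)) (sym (odd-size (suc h)))
           (≤-trans (m≤n⇒m≤1+n ≤-refl) (≤-pred (subst₂ _≤_ (+-comm _ 2) (+-comm _ 1) large))))
  with size ← trans (order-suc (double (suc h)) 2 μ) (cong suc (trans (odd-order (suc h) μ) (cong double N≡)))
  with G , cc , e ← build (double (suc h)) 3 μ (OddCore.core (suc h) 2 (s≤s (s≤s z≤n))) 1
         (OddCore.sum-outer (suc h) 2 (s≤s (s≤s z≤n))) _ κ≤μ size =
  G , cc , (λ _ → trans (cong (_+ 3 * suc κ) e) (trans (odd-odd κ μ) (cong (λ i → (suc κ + 2) * i + 4) size))) , λ ()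
  where κ = double (suc h)
theorem3p2 _ _ 3≤k large | even (suc (suc h)) k-even | even N n-even rewrite k-even | n-even
  with μ , κ≤μ , N≡ ← fit (suc (double (suc h))) (4 + suc h) N
         (subst (_≤ suc (double N)) (sym (even-size (suc h))) (s≤s (subst₂ _≤_ (+-identityʳ _) (+-identityʳ _) large)))
  with size ← trans (even-order (suc h) μ) (cong double N≡)
  with G , cc , e ← build (suc (double (suc h))) 3 μ (EvenCore.core h 1 ≤-refl) _
         (EvenCore.sum-outer h 1 ≤-refl) _ κ≤μ size =
  G , cc , (λ ()) , λ _ → trans (cong (λ i → i + 2 * suc κ + 0) e) (trans (even-even κ μ) (cong (λ i → (suc κ + 2) * i + 2) size))
  where κ = suc (double (suc h))
-- Now `L` has two vertices. The parameter `μ` is found from the even order n + 1, which a third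
-- vertex in `L` would give; hence `suc N` and the later subtraction of one.
theorem3p2 _ _ 3≤k large | even (suc (suc h)) k-even | odd N n-odd rewrite k-even | n-odd
  with μ , κ≤μ , sucN≡ ← fit (suc (double (suc h))) (4 + suc h) (suc N)
         (subst (_≤ suc (double (suc N))) (sym (even-size (suc h))) (s≤s (subst₂ _≤_ (+-identityʳ _) (+-comm _ 1) large)))
  with size ← cong (_∸ 1) (trans (sym (order-suc (suc (double (suc h))) 2 μ)) (trans (even-order (suc h) μ) (cong double sucN≡)))
  with G , cc , e ← build (suc (double (suc h))) 2 μ (EvenCore.core h 0 z≤n) _
         (EvenCore.sum-outer h 0 z≤n) _ κ≤μ size =
  G , cc , (λ ()) , λ _ → trans (cong (λ i → i + 1 * suc κ + 4) e) (trans (even-odd κ μ) (cong (λ i → (suc κ + 2) * i + 2) size))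
  where κ = suc (double (suc h))
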